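{- Let $n \geq 2$. The set of all ordered multiplicity lists attained by matrices in $\mathcal{S}_L(K_{1,n-1})$ is exactly the set of lists $(m_1, \ldots, m_q)$ of positive integers (of any length $q$) such that: (i) $m_1 = m_q = 1$; (ii) for all $k$ with $1\le k\le q-1$, $m_k \geq 2$ implies $m_{k+1} = 1$; and (iii) $m_1 + \cdots + m_q = n$.
   Context: Graphs are finite and simple; $K_{1,n-1}$ is the star on $n$ vertices. For a graph $G$ on $n$ vertices, $\mathcal{S}_L(G)$ denotes the set of $n\times n$ real symmetric matrices $A=[a_{i,j}]$ such that $a_{i,j}<0$ if $\{i,j\}\in E(G)$, $a_{i,j}=0$ if $i\neq j$ and $\{i,j\}\notin E(G)$, and $a_{i,i}=-\sum_{k\neq i}a_{i,k}$ for all $i$. The ordered multiplicity list of $A\in\mathcal{S}_L(G)$ is $(m_1,\ldots,m_q)$, where $\lambda_1<\lambda_2<\cdots<\lambda_q$ are the distinct eigenvalues of $A$ in increasing order and $m_i$ is the multiplicity of $\lambda_i$. -}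

module Defs where

open import Level using (_⊔_; 0ℓ) renaming (suc to lsuc)
open import Algebra.Apartness.Bundles using (HeytingField; HeytingCommutativeRing)
open import Algebra.Bundles using (CommutativeRing)
import Algebra.Definitions.RawMonoid as RawMonoidDefinitions
open import Data.Bool.Base using (if_then_else_)
open import Data.Fin.Base using (Fin; toℕ)
import Data.Fin.Base as Fin
open import Data.Fin.Properties using () renaming (_≟_ to _≟ᶠ_)
open import Data.List.Base using (List; length; lookup; head; last; sum)
open import Data.List.Relation.Unary.All using (All)
open import Data.List.Relation.Unary.Linked using (Linked)
open import Data.Maybe.Base using (just)
open import Data.Nat.Base as ℕ using (ℕ)
import Data.Nat.Properties as ℕ
open import Data.Product.Base using (_×_; _,_; ∃; ∃-syntax)
open import Data.Sum.Base using (_⊎_; inj₁; inj₂)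
open import Data.Vec.Functional using (Vector)
open import Function.Bundles using (_⇔_)
open import Relation.Binary.Core using (Rel)
open import Relation.Binary.Definitions using (Symmetric; Irreflexive; Decidable)
open import Relation.Binary.PropositionalEquality using (_≡_; refl)
open import Relation.Binary.Structures using (IsStrictPartialOrder)
open import Relation.Nullary.Decidable using (does; ¬?; _×-dec_; _⊎-dec_)
open import Relation.Nullary.Negation using (¬_)

-- The real numbers, given by the axioms that determine them up to
-- isomorphism: an Archimedean, Cauchy complete ordered field.  The axioms are
-- in constructive form.  For the classical reals, with x # y read as x ≠ y,
-- they are the usual ones: `#⇔<⊎>` is trichotomy, tightness of # is stability
-- of equality, and `#⇒invertible` is division by nonzero numbers.
record RealNumbers c ℓ₁ ℓ₂ : Set (lsuc (c ⊔ ℓ₁ ⊔ ℓ₂)) where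
  infix 4 _<_
  field
    heytingField : HeytingField c ℓ₁ ℓ₂

  open HeytingField heytingField public
  open HeytingCommutativeRing heytingCommutativeRing public
    using (commutativeRing)
  open CommutativeRing commutativeRing public using (+-rawMonoid)

  open RawMonoidDefinitions +-rawMonoid public
    using () renaming (sum to ∑; _×_ to _·_)

  field
    _<_                  : Rel Carrier ℓ₂
    isStrictPartialOrder : IsStrictPartialOrder _≈_ _<_
    #⇔<⊎>                : ∀ {x y} → (x # y) ⇔ (x < y ⊎ y < x)
    +-monoʳ-<            : ∀ z {x y} → x < y → z + x < z + y
    *-pos                : ∀ {x y} → 0# < x → 0# < y → 0# < x * y
    archimedean          : ∀ x → ∃[ n ] x < n · 1#

  Cauchy : (ℕ → Carrier) → Set (c ⊔ ℓ₂)
  Cauchy s = ∀ ε → 0# < ε →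
    ∃[ N ] (∀ m n → N ℕ.≤ m → N ℕ.≤ n → s m < s n + ε)

  _ConvergesTo_ : (ℕ → Carrier) → Carrier → Set (c ⊔ ℓ₂)
  s ConvergesTo x = ∀ ε → 0# < ε →
    ∃[ N ] (∀ n → N ℕ.≤ n → s n < x + ε × x < s n + ε)

  field
    complete : ∀ s → Cauchy s → ∃[ x ] s ConvergesTo x

record SimpleGraph (n : ℕ) : Set₁ where
  field
    Adj    : Rel (Fin n) 0ℓ
    adj?   : Decidable Adj
    sym    : Symmetric Adj
    irrefl : Irreflexive _≡_ Adj

-- K₁,ₙ₋₁ on the vertex set Fin n, with centre 0.
star : ∀ n → SimpleGraph n
star n = record
  { Adj    = λ i j → (Centre i × ¬ Centre j) ⊎ (¬ Centre i × Centre j)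
  ; adj?   = λ i j → (centre? i ×-dec ¬? (centre? j))
                     ⊎-dec (¬? (centre? i) ×-dec centre? j)
  ; sym    = λ { (inj₁ (p , q)) → inj₂ (q , p) ; (inj₂ (p , q)) → inj₁ (q , p) }
  ; irrefl = λ { refl (inj₁ (p , q)) → q p ; refl (inj₂ (p , q)) → p q }
  }
  where
  Centre : Fin n → Set
  Centre i = toℕ i ≡ 0

  centre? = λ (i : Fin n) → toℕ i ℕ.≟ 0

module Spectrum {c ℓ₁ ℓ₂} (ℝ : RealNumbers c ℓ₁ ℓ₂) where
  open RealNumbers ℝ renaming (Carrier to R) hiding (sym; refl)

  Matrix : ℕ → Set c
  Matrix n = Fin n → Fin n → R

  record _∈𝒮ᴸ_ {n} (A : Matrix n) (G : SimpleGraph n) : Set (ℓ₁ ⊔ ℓ₂) where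
    open SimpleGraph G using (Adj)
    field
      symmetric : ∀ i j → A i j ≈ A j i
      edge      : ∀ i j → Adj i j → A i j < 0#
      nonEdge   : ∀ i j → ¬ i ≡ j → ¬ Adj i j → A i j ≈ 0#
      diagonal  : ∀ i →
        A i i ≈ - ∑ (λ k → if does (k ≟ᶠ i) then 0# else A i k)

  InEigenspace : ∀ {n} → Matrix n → R → Vector R n → Set ℓ₁
  InEigenspace A μ v = ∀ i → ∑ (λ j → A i j * v j) ≈ μ * v i

  IsEigenvalue : ∀ {n} → Matrix n → R → Set (c ⊔ ℓ₁ ⊔ ℓ₂)
  IsEigenvalue A μ = ∃[ v ] (∃[ i ] v i # 0#) × InEigenspace A μ v

  combination : ∀ {n m} → Vector R m → Vector (Vector R n) m → Vector R n
  combination a u i = ∑ (λ k → a k * u k i)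

  record IsEigenbasis {n m} (A : Matrix n) (μ : R)
                      (u : Vector (Vector R n) m) : Set (c ⊔ ℓ₁) where
    field
      inEigenspace : ∀ k → InEigenspace A μ (u k)
      independent  : ∀ a → (∀ i → combination a u i ≈ 0#) → ∀ k → a k ≈ 0#
      spanning     : ∀ v → InEigenspace A μ v →
                     ∃[ a ] (∀ i → v i ≈ combination a u i)

  -- The dimension of the eigenspace; for the symmetric matrices considered
  -- here it is also the multiplicity of μ as a root of the characteristic
  -- polynomial.
  HasMultiplicity : ∀ {n} → Matrix n → R → ℕ → Set (c ⊔ ℓ₁)
  HasMultiplicity {n} A μ m = ∃ λ (u : Vector (Vector R n) m) → IsEigenbasis A μ u

  record IsOrderedMultiplicityList {n} (A : Matrix n) (ms : List ℕ)
         : Set (c ⊔ ℓ₁ ⊔ ℓ₂) where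
    field
      eigenvalue   : Fin (length ms) → R
      increasing   : ∀ i j → i Fin.< j → eigenvalue i < eigenvalue j
      spectrum     : ∀ μ → IsEigenvalue A μ ⇔ (∃[ i ] μ ≈ eigenvalue i)
      multiplicity : ∀ i → HasMultiplicity A (eigenvalue i) (lookup ms i)

  AttainedBy : ∀ {n} → SimpleGraph n → List ℕ → Set (c ⊔ ℓ₁ ⊔ ℓ₂)
  AttainedBy G ms = ∃[ A ] (A ∈𝒮ᴸ G) × IsOrderedMultiplicityList A ms

record Admissible (n : ℕ) (ms : List ℕ) : Set where
  field
    positive  : All (0 ℕ.<_) ms
    first     : head ms ≡ just 1
    final     : last ms ≡ just 1
    isolated  : Linked (λ m m′ → 2 ℕ.≤ m → m′ ≡ 1) ms
    total     : sum ms ≡ n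

{-# OPTIONS --safe #-}

-- Let d be the leaf weights of the star and write v₀ for the value of v at
-- the centre.  Then v is an eigenvector for μ when dᵢ (vᵢ - v₀) = μ vᵢ at
-- every leaf i and μ ∑ v = 0.  A weight e shared by k + 1 leaves is an
-- eigenvalue of multiplicity k, with the vectors supported on these leaves
-- and of sum 0.  Off the weights, v is determined by v₀, and μ ≠ 0 is a
-- (simple) eigenvalue exactly when ∑ dᵢ / (μ - dᵢ) = 1.  The left-hand side
-- is negative below all weights and decreases from +∞ to -∞ between
-- consecutive weights and from +∞ to 0 beyond the last, so it takes the value
-- 1 exactly once above each weight.  Hence the multiplicity list is 1
-- followed, for each weight in increasing order, by k (if k > 0) and 1.
--
-- Constructively, the roots are found by a search that only needs the
-- cotransitivity of <.  Admissibility is decidable, so the leaf weights of a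
-- given matrix may be compared classically to group them.
module Submission where

open import Algebra.Bundles using (CommutativeRing; RawRing)
import Algebra.Apartness.Properties.HeytingCommutativeRing as HeytingProperties
import Algebra.Solver.Ring
open import Algebra.Solver.Ring.AlmostCommutativeRing
  using (_-Raw-AlmostCommutative⟶_; fromCommutativeRing)
open import Data.Bool.Base using (if_then_else_)
open import Data.Fin.Base as Fin using (Fin; zero; suc; punchIn)
open import Data.Fin.Properties using (suc-injective; _≟_)
open import Data.List.Base using (List; []; _∷_; length; lookup; map; last)
open import Data.List.Properties using (map-∘)
open import Data.List.Relation.Binary.Permutation.Propositional
  using (_↭_; ↭-refl; ↭-sym; ↭-trans; prep; swap)
open import Data.List.Relation.Binary.Permutation.Propositional.Properties
  using (All-resp-↭; Any-resp-↭; map⁺)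
open import Data.List.Relation.Unary.All as All using (All; []; _∷_)
open import Data.List.Relation.Unary.AllPairs using (AllPairs; []; _∷_)
open import Data.List.Relation.Unary.Any using (Any; here; there)
open import Data.List.Relation.Unary.Linked using (Linked; [-]; _∷_; linked?)
open import Data.Maybe.Base using (Maybe; just; nothing)
import Data.Maybe.Properties as Maybe
open import Data.Nat.Base as ℕ using (ℕ; zero; suc; s≤s; z≤n)
open import Data.Nat.ListAction using (sum)
open import Data.Nat.ListAction.Properties using (sum-↭)
import Data.Nat.Properties as ℕ
open import Data.Product.Base using (_×_; _,_; proj₁; proj₂; ∃; ∃-syntax)
open import Data.Product.Properties using (≡-dec)
open import Data.Sum.Base using (_⊎_; inj₁; inj₂; [_,_]′)
open import Data.Vec.Functional using (Vector; insertAt) renaming (_∷_ to _∷ᵛ_)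
open import Data.Vec.Functional.Properties using (insertAt-lookup; insertAt-punchIn)
open import Function.Base using (_∘_)
open import Function.Bundles using (_⇔_; mk⇔; module Equivalence)
open import Level using (Level; _⊔_)
open import Relation.Binary.PropositionalEquality as ≡ using (_≡_; _≢_)
open import Relation.Binary.Structures using (IsStrictPartialOrder)
open import Relation.Nullary.Decidable using (does; yes; no; decidable-stable; _→-dec_)
open import Relation.Nullary.Negation using (¬_; contradiction; ¬¬-map; Stable)
open import Defs

-- Neither equality nor order of the field is decidable, and this shapes the statements below.
-- Completeness of a list of eigenvalues is first proved as a negation, no eigenvalue being apart
-- from all listed values, so that its proof may split cases; an index is extracted only afterwards.
-- Division never occurs as an operation: reciprocals travel as vectors together with their defining
-- equations, and identities between them are certified by a ring solver modulo these equations.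
--
-- Computing one multiplicity list of a matrix does not by itself say anything about another list
-- that is given for it. The two agree because dimensions are well defined and a strictly increasing
-- enumeration of a set of reals is unique; this is where elimination enters.
--
-- Conversely, the multiplicities depend only on the sizes of the groups of equal weights, so any
-- increasing positive weights realise a given list. What remains is to see that the admissible
-- lists are exactly those read off from a list of group sizes.

-- A ring solver with integer coefficients.

module IntegerSolver {c ℓ : Level} (CR : CommutativeRing c ℓ) where
  open CommutativeRing CR
  open import Algebra.Properties.Ring ring
    using (-0#≈0#; -‿distribˡ-*; -‿distribʳ-*; -‿involutive)
  open import Algebra.Properties.AbelianGroup +-abelianGroup using (⁻¹-∙-comm)
  open import Algebra.Properties.Semiring.Mult semiring
    using (×-homo-+; ×1-homo-*) renaming (_×_ to _·_)
  open import Algebra.Properties.CommutativeSemigroup +-commutativeSemigroup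
    using (interchange)
  open import Relation.Binary.Reasoning.Setoid setoid

  -- The pair (m , n) stands for the integer m - n; one of m and n is 0.
  Coefficient : Set
  Coefficient = ℕ × ℕ

  -- Cancelling makes equality of integers coincide with equality of pairs. The solver has to decide
  -- equality of coefficients, which the carrier of the ring does not offer.
  normalise : ℕ → ℕ → Coefficient
  normalise (suc m) (suc n) = normalise m n
  normalise m       n       = m , n

  coefficients : RawRing _ _
  coefficients = record
    { Carrier = Coefficient
    ; _≈_     = _≡_
    ; _+_     = λ (m , n) (o , p) → normalise (m ℕ.+ o) (n ℕ.+ p)
    ; _*_     = λ (m , n) (o , p) →
        normalise (m ℕ.* o ℕ.+ n ℕ.* p) (m ℕ.* p ℕ.+ n ℕ.* o)
    ; -_      = λ (m , n) → n , m
    ; 0#      = 0 , 0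
    ; 1#      = 1 , 0
    }

  numeral : ℕ → Carrier
  numeral 0             = 0#
  numeral 1             = 1#
  numeral (suc (suc n)) = 1# + numeral (suc n)

  -- The cases make the constants 0 and 1 evaluate to 0# and 1# on the nose.
  ⟦_⟧ : Coefficient → Carrier
  ⟦ m , zero  ⟧ = numeral m
  ⟦ m , suc n ⟧ = numeral m - numeral (suc n)

  numeral-· : ∀ n → numeral n ≈ n · 1#
  numeral-· 0             = refl
  numeral-· 1             = sym (+-identityʳ 1#)
  numeral-· (suc (suc n)) = +-congˡ (numeral-· (suc n))

  ⟦⟧-difference : ∀ m n → ⟦ m , n ⟧ ≈ m · 1# - n · 1#
  ⟦⟧-difference m zero    = begin
    numeral m     ≈⟨ numeral-· m ⟩
    m · 1#        ≈⟨ +-identityʳ _ ⟨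
    m · 1# + 0#   ≈⟨ +-congˡ -0#≈0# ⟨
    m · 1# - 0#   ∎
  ⟦⟧-difference m (suc n) =
    +-cong (numeral-· m) (-‿cong (numeral-· (suc n)))

  minus-+ : ∀ w x y z → (w + x) - (y + z) ≈ (w - y) + (x - z)
  minus-+ w x y z = begin
    (w + x) - (y + z)     ≈⟨ +-congˡ (⁻¹-∙-comm y z) ⟨
    (w + x) + (- y - z)   ≈⟨ interchange w x (- y) (- z) ⟩
    (w - y) + (x - z)     ∎

  normalise-sound : ∀ m n → ⟦ normalise m n ⟧ ≈ m · 1# - n · 1#
  normalise-sound zero    n       = ⟦⟧-difference 0 n
  normalise-sound (suc m) zero    = ⟦⟧-difference (suc m) 0
  normalise-sound (suc m) (suc n) = begin
    ⟦ normalise m n ⟧                 ≈⟨ normalise-sound m n ⟩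
    m · 1# - n · 1#                   ≈⟨ +-identityˡ _ ⟨
    0# + (m · 1# - n · 1#)            ≈⟨ +-congʳ (-‿inverseʳ 1#) ⟨
    (1# - 1#) + (m · 1# - n · 1#)     ≈⟨ minus-+ _ _ _ _ ⟨
    (1# + m · 1#) - (1# + n · 1#)     ∎

  +-homo : ∀ m n o p →
    ⟦ normalise (m ℕ.+ o) (n ℕ.+ p) ⟧ ≈ ⟦ m , n ⟧ + ⟦ o , p ⟧
  +-homo m n o p = begin
    ⟦ normalise (m ℕ.+ o) (n ℕ.+ p) ⟧           ≈⟨ normalise-sound (m ℕ.+ o) (n ℕ.+ p) ⟩
    (m ℕ.+ o) · 1# - (n ℕ.+ p) · 1#             ≈⟨ +-cong (×-homo-+ 1# m o) (-‿cong (×-homo-+ 1# n p)) ⟩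
    (m · 1# + o · 1#) - (n · 1# + p · 1#)       ≈⟨ minus-+ _ _ _ _ ⟩
    (m · 1# - n · 1#) + (o · 1# - p · 1#)       ≈⟨ +-cong (⟦⟧-difference m n) (⟦⟧-difference o p) ⟨
    ⟦ m , n ⟧ + ⟦ o , p ⟧                       ∎

  minus-* : ∀ w x y z → (w - x) * (y - z) ≈ (w * y + x * z) - (w * z + x * y)
  minus-* w x y z = begin
    (w - x) * (y - z)                                ≈⟨ distribʳ _ _ _ ⟩
    w * (y - z) + (- x) * (y - z)                    ≈⟨ +-cong (distribˡ _ _ _) (distribˡ _ _ _) ⟩
    (w * y + w * - z) + ((- x) * y + (- x) * - z)    ≈⟨ +-cong (+-congˡ (-‿distribʳ-* w z))
                                                          (+-cong (-‿distribˡ-* x y) (trans (sym (-‿distribˡ-* _ _)) (-‿distribʳ-* _ _))) ⟨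
    (w * y - w * z) + (- (x * y) + - (- x) * z)      ≈⟨ +-congˡ (+-comm _ _) ⟩
    (w * y - w * z) + (- (- x) * z - x * y)          ≈⟨ +-congˡ (+-congʳ (*-congʳ (-‿involutive x))) ⟩
    (w * y - w * z) + (x * z - x * y)                ≈⟨ minus-+ _ _ _ _ ⟨
    (w * y + x * z) - (w * z + x * y)                ∎

  *-homo : ∀ m n o p →
    ⟦ normalise (m ℕ.* o ℕ.+ n ℕ.* p) (m ℕ.* p ℕ.+ n ℕ.* o) ⟧ ≈ ⟦ m , n ⟧ * ⟦ o , p ⟧
  *-homo m n o p = begin
    ⟦ normalise (m ℕ.* o ℕ.+ n ℕ.* p) (m ℕ.* p ℕ.+ n ℕ.* o) ⟧
      ≈⟨ normalise-sound (m ℕ.* o ℕ.+ n ℕ.* p) (m ℕ.* p ℕ.+ n ℕ.* o) ⟩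
    (m ℕ.* o ℕ.+ n ℕ.* p) · 1# - (m ℕ.* p ℕ.+ n ℕ.* o) · 1#
      ≈⟨ +-cong (·-bilinear m o n p) (-‿cong (·-bilinear m p n o)) ⟩
    (m · 1# * (o · 1#) + n · 1# * (p · 1#)) - (m · 1# * (p · 1#) + n · 1# * (o · 1#))
      ≈⟨ minus-* _ _ _ _ ⟨
    (m · 1# - n · 1#) * (o · 1# - p · 1#)
      ≈⟨ *-cong (⟦⟧-difference m n) (⟦⟧-difference o p) ⟨
    ⟦ m , n ⟧ * ⟦ o , p ⟧ ∎
    where
    ·-bilinear : ∀ i j k l →
      (i ℕ.* j ℕ.+ k ℕ.* l) · 1# ≈ i · 1# * (j · 1#) + k · 1# * (l · 1#)
    ·-bilinear i j k l =
      trans (×-homo-+ 1# (i ℕ.* j) (k ℕ.* l)) (+-cong (×1-homo-* i j) (×1-homo-* k l))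

  -‿homo : ∀ m n → ⟦ n , m ⟧ ≈ - ⟦ m , n ⟧
  -‿homo m n = begin
    ⟦ n , m ⟧                        ≈⟨ ⟦⟧-difference n m ⟩
    n · 1# - m · 1#                  ≈⟨ +-comm _ _ ⟩
    - (m · 1#) + n · 1#              ≈⟨ +-congˡ (-‿involutive _) ⟨
    - (m · 1#) + - - (n · 1#)        ≈⟨ ⁻¹-∙-comm _ _ ⟩
    - (m · 1# - n · 1#)              ≈⟨ -‿cong (⟦⟧-difference m n) ⟨
    - ⟦ m , n ⟧                      ∎

  morphism : coefficients -Raw-AlmostCommutative⟶ fromCommutativeRing CR
  morphism = record
    { ⟦_⟧    = ⟦_⟧
    ; +-homo = λ (m , n) (o , p) → +-homo m n o p
    ; *-homo = λ (m , n) (o , p) → *-homo m n o p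
    ; -‿homo = λ (m , n) → -‿homo m n
    ; 0-homo = refl
    ; 1-homo = refl
    }

  equal? : ∀ x y → Maybe (⟦ x ⟧ ≈ ⟦ y ⟧)
  equal? x y with ≡-dec ℕ._≟_ ℕ._≟_ x y
  ... | yes x≡y = just (reflexive (≡.cong ⟦_⟧ x≡y))
  ... | no  _   = nothing

  open Algebra.Solver.Ring coefficients (fromCommutativeRing CR) morphism equal? public
    using (Polynomial; solve; con; _:+_; _:*_; _:-_; :-_; _:=_)

  :0 :1 : ∀ {n} → Polynomial n
  :0 = con (0 , 0)
  :1 = con (1 , 0)

-- Consequences of the axioms of the real numbers.

module RealProperties {c ℓ₁ ℓ₂ : Level} (ℝ : RealNumbers c ℓ₁ ℓ₂) where
  open RealNumbers ℝ public hiding (zero) renaming (Carrier to R)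
  open CommutativeRing commutativeRing public using (ring; semiring)
  open IntegerSolver commutativeRing public
    using (solve; :0; :1; _:+_; _:*_; _:-_; :-_; _:=_)
  open HeytingProperties heytingCommutativeRing public
    using (1#0; #-congʳ; #-congˡ)
  open import Algebra.Properties.Semiring.Sum semiring public
    using (sum-cong-≋; ∑-distrib-+; ∑-comm; *-distribˡ-sum; *-distribʳ-sum; sum-replicate-zero; sum-remove)
  open import Algebra.Properties.Semiring.Mult semiring public
    using (×-assoc-*; ×-congʳ)
  open IsStrictPartialOrder isStrictPartialOrder public
    using (<-respʳ-≈; <-respˡ-≈)
    renaming (trans to <-trans; irrefl to <-irrefl)

  infix 4 _≤_
  -- Being a negation, such a goal may be proved by cases under a double negation, and carries no
  -- data.
  _≤_ : R → R → Set ℓ₂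
  x ≤ y = ¬ y < x

  <⇒# : ∀ {x y} → x < y → x # y
  <⇒# x<y = Equivalence.from #⇔<⊎> (inj₁ x<y)

  >⇒# : ∀ {x y} → y < x → x # y
  >⇒# y<x = Equivalence.from #⇔<⊎> (inj₂ y<x)

  #⇒<⊎> : ∀ {x y} → x # y → x < y ⊎ y < x
  #⇒<⊎> = Equivalence.to #⇔<⊎>

  <-asym : ∀ {x y} → x < y → x ≤ y
  <-asym x<y y<x = <-irrefl refl (<-trans x<y y<x)

  <-cotrans : ∀ {x y} → x < y → ∀ z → x < z ⊎ z < y
  <-cotrans x<y z with #-cotrans (<⇒# x<y) z
  ... | inj₁ x#z = [ inj₁ , (λ z<x → inj₂ (<-trans z<x x<y)) ]′ (#⇒<⊎> x#z)
  ... | inj₂ z#y = [ inj₂ , (λ y<z → inj₁ (<-trans x<y y<z)) ]′ (#⇒<⊎> z#y)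

  ≤-antisym : ∀ {x y} → x ≤ y → y ≤ x → x ≈ y
  ≤-antisym x≤y y≤x = proj₁ (tight _ _) λ x#y → [ y≤x , x≤y ]′ (#⇒<⊎> x#y)

  ≤-<-trans : ∀ {x y z} → x ≤ y → y < z → x < z
  ≤-<-trans {x} x≤y y<z = [ (λ y<x → contradiction y<x x≤y) , (λ x<z → x<z) ]′ (<-cotrans y<z x)

  <-≤-trans : ∀ {x y z} → x < y → y ≤ z → x < z
  <-≤-trans {z = z} x<y y≤z = [ (λ x<z → x<z) , (λ z<y → contradiction z<y y≤z) ]′ (<-cotrans x<y z)

  ≈⇒≤ : ∀ {x y} → x ≈ y → x ≤ y
  ≈⇒≤ x≈y y<x = <-irrefl (sym x≈y) y<x

  -- Refuting both strict inequalities yields equality by tightness, so trichotomy cannot be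
  -- refuted. It is available whenever the goal is a negation.
  ¬¬-trichotomous : ∀ x y → ¬ ¬ (x < y ⊎ x ≈ y ⊎ y < x)
  ¬¬-trichotomous x y k =
    k (inj₂ (inj₁ (≤-antisym (λ y<x → k (inj₂ (inj₂ y<x))) (λ x<y → k (inj₁ x<y)))))

  <-resp : ∀ {x x′ y y′} → x ≈ x′ → y ≈ y′ → x < y → x′ < y′
  <-resp x≈x′ y≈y′ x<y = <-respˡ-≈ x≈x′ (<-respʳ-≈ y≈y′ x<y)

  <⇒pos : ∀ {x y} → x < y → 0# < y - x
  <⇒pos {x} {y} x<y = <-resp
    (solve 1 (λ x → :- x :+ x := :0) refl x)
    (solve 2 (λ x y → :- x :+ y := y :- x) refl x y)
    (+-monoʳ-< (- x) x<y)

  -- Reduces an inequality to algebra: the difference is written as an expression `z` that is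
  -- visibly positive, and the solver checks the identity.
  <-by : ∀ {x y z} → 0# < z → y - x ≈ z → x < y
  <-by {x} {y} {z} 0<z y-x≈z = <-resp (+-identityʳ x)
    (trans (+-congˡ (sym y-x≈z)) (solve 2 (λ x y → x :+ (y :- x) := y) refl x y))
    (+-monoʳ-< x 0<z)

  ≤-by : ∀ {x y z} → 0# ≤ z → y - x ≈ z → x ≤ y
  ≤-by {x} {y} {z} 0≤z y-x≈z y<x = 0≤z (<-by (<⇒pos y<x) (trans (+-congˡ (-‿cong (sym y-x≈z)))
    (solve 2 (λ x y → :0 :- (y :- x) := x :- y) refl x y)))

  ≤⇒nonNeg : ∀ {x y} → x ≤ y → 0# ≤ y - x
  ≤⇒nonNeg {x} {y} x≤y y-x<0 = x≤y (<-by (<⇒pos y-x<0)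
    (solve 2 (λ x y → x :- y := :0 :- (y :- x)) refl x y))

  -- Serves for equations that hold only modulo hypotheses such as `v * x ≈ 1#`. Here `z` is a
  -- combination of the hypotheses with explicit multipliers, that is, a certificate whose
  -- polynomial identity the solver checks.
  ≈-by : ∀ {x y z} → z ≈ 0# → y - x ≈ z → x ≈ y
  ≈-by {x} {y} z≈0 y-x≈z = trans
    (trans (sym (+-identityʳ x)) (+-congˡ (sym (trans y-x≈z z≈0))))
    (solve 2 (λ x y → x :+ (y :- x) := y) refl x y)

  ≈⇒zero : ∀ {x y} → x ≈ y → y - x ≈ 0#
  ≈⇒zero x≈y = trans (+-congˡ (-‿cong x≈y)) (-‿inverseʳ _)

  zero-* : ∀ x {y} → y ≈ 0# → x * y ≈ 0#
  zero-* x y≈0 = trans (*-congˡ y≈0) (zeroʳ x)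

  zero-+ : ∀ {x y} → x ≈ 0# → y ≈ 0# → x + y ≈ 0#
  zero-+ x≈0 y≈0 = trans (+-cong x≈0 y≈0) (+-identityˡ 0#)

  pos-+-nonNeg : ∀ {x y} → 0# < x → 0# ≤ y → 0# < x + y
  pos-+-nonNeg {x} {y} 0<x 0≤y with <-cotrans 0<x (x + y)
  ... | inj₁ 0<x+y = 0<x+y
  ... | inj₂ x+y<x = contradiction
    (<-by (<⇒pos x+y<x) (solve 2 (λ x y → :0 :- y := x :- (x :+ y)) refl x y)) 0≤y

  pos-+ : ∀ {x y} → 0# < x → 0# < y → 0# < x + y
  pos-+ 0<x 0<y = pos-+-nonNeg 0<x (<-asym 0<y)

  nonNeg-+ : ∀ {x y} → 0# ≤ x → 0# ≤ y → 0# ≤ x + y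
  nonNeg-+ {x} {y} 0≤x 0≤y x+y<0 = 0≤x (<-by
    (pos-+-nonNeg (<⇒pos x+y<0) 0≤y)
    (solve 2 (λ x y → :0 :- x := (:0 :- (x :+ y)) :+ y) refl x y))

  nonNeg-* : ∀ {x y} → 0# ≤ x → 0# ≤ y → 0# ≤ x * y
  nonNeg-* {x} {y} 0≤x 0≤y xy<0 =
    ¬¬-trichotomous 0# x λ where
      (inj₂ (inj₂ x<0)) → 0≤x x<0
      (inj₂ (inj₁ 0≈x)) → <-irrefl (trans (*-congʳ (sym 0≈x)) (zeroˡ y)) xy<0
      (inj₁ 0<x) → ¬¬-trichotomous 0# y λ where
        (inj₂ (inj₂ y<0)) → 0≤y y<0
        (inj₂ (inj₁ 0≈y)) → <-irrefl (trans (*-congˡ (sym 0≈y)) (zeroʳ x)) xy<0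
        (inj₁ 0<y) → <-asym (*-pos 0<x 0<y) xy<0

  0<1 : 0# < 1#
  0<1 with #⇒<⊎> 1#0
  ... | inj₂ 0<1 = 0<1
  ... | inj₁ 1<0 = <-respʳ-≈ (solve 0 ((:0 :- :1) :* (:0 :- :1) := :1) refl)
    (*-pos (<⇒pos 1<0) (<⇒pos 1<0))

  inverse : ∀ {x y} → x # y → ∃[ v ] v * (x - y) ≈ 1#
  inverse x#y = let v , v*[x-y]≈1 , _ = #⇒invertible x#y in v , v*[x-y]≈1

  inverse₀ : ∀ {x} → x # 0# → ∃[ v ] v * x ≈ 1#
  inverse₀ {x} x#0 = let v , eq = inverse x#0 in
    v , trans (*-congˡ (solve 1 (λ x → x := x :- :0) refl x)) eq

  inverse-# : ∀ {v x} → v * x ≈ 1# → v # 0#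
  inverse-# {v} {x} v*x≈1 = invertible⇒#
    ( x
    , trans (solve 2 (λ v x → x :* (v :- :0) := v :* x) refl v x) v*x≈1
    , trans (solve 2 (λ v x → (v :- :0) :* x := v :* x) refl v x) v*x≈1)

  #0-cancelˡ : ∀ {x y} → x # 0# → x * y ≈ 0# → y ≈ 0#
  #0-cancelˡ {x} {y} x#0 x*y≈0 = let v , v*x≈1 = inverse₀ x#0 in begin
    y             ≈⟨ *-identityˡ y ⟨
    1# * y        ≈⟨ *-congʳ v*x≈1 ⟨
    v * x * y     ≈⟨ *-assoc v x y ⟩
    v * (x * y)   ≈⟨ zero-* v x*y≈0 ⟩
    0#            ∎
    where open import Relation.Binary.Reasoning.Setoid setoid

  inverse-pos : ∀ {v x} → v * x ≈ 1# → 0# < x → 0# < v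
  inverse-pos {v} {x} v*x≈1 0<x with #⇒<⊎> (inverse-# v*x≈1)
  ... | inj₂ 0<v = 0<v
  ... | inj₁ v<0 = contradiction
    (<-by (*-pos (<⇒pos v<0) 0<x)
      (trans (+-congˡ (-‿cong (sym v*x≈1)))
        (solve 2 (λ v x → :0 :- v :* x := (:0 :- v) :* x) refl v x)))
    (<-asym 0<1)

  reciprocal : ∀ {x} → 0# < x → ∃[ v ] 0# < v × v * x ≈ 1#
  reciprocal 0<x = let v , v*x≈1 = inverse₀ (>⇒# 0<x) in v , inverse-pos v*x≈1 0<x , v*x≈1

  pos-cancelʳ : ∀ {x y} → 0# < x * y → 0# < y → 0# < x
  pos-cancelʳ {x} {y} 0<xy 0<y = let v , 0<v , v*y≈1 = reciprocal 0<y in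
    <-respʳ-≈ (trans (*-assoc x y v) (trans (*-congˡ (trans (*-comm y v) v*y≈1)) (*-identityʳ x)))
      (*-pos 0<xy 0<v)

  halve : ∀ {x} → 0# < x → ∃[ y ] 0# < y × y + y ≈ x
  halve {x} 0<x = let h , 0<h , h*2≈1 = reciprocal (pos-+ 0<1 0<1) in
    h * x , *-pos 0<h 0<x ,
    trans (solve 2 (λ h x → h :* x :+ h :* x := h :* (:1 :+ :1) :* x) refl h x)
      (trans (*-congʳ h*2≈1) (*-identityˡ x))

  archimedean-multiple : ∀ x {y} → 0# < y → ∃[ n ] x < n · y
  archimedean-multiple x {y} 0<y =
    let v , 0<v , v*y≈1 = reciprocal 0<y
        n , x*v<n = archimedean (x * v)
    in n , <-resp
      (trans (*-assoc x v y) (trans (*-congˡ v*y≈1) (*-identityʳ x)))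
      (trans (×-assoc-* n 1# y) (×-congʳ n (*-identityˡ y)))
      (<-by (*-pos (<⇒pos x*v<n) 0<y)
        (solve 3 (λ a b y → b :* y :- a :* y := (b :- a) :* y) refl (x * v) (n · 1#) y))

  pos-· : ∀ n → 0# < suc n · 1#
  pos-· zero    = pos-+-nonNeg 0<1 (<-irrefl refl)
  pos-· (suc n) = pos-+ 0<1 (pos-· n)

  ·-mono-≤ : ∀ {m n} → m ℕ.≤ n → m · 1# ≤ n · 1#
  ·-mono-≤ {n = zero}  ℕ.z≤n       = <-irrefl refl
  ·-mono-≤ {n = suc n} ℕ.z≤n       = <-asym (pos-· n)
  ·-mono-≤ {suc m} {suc n} (ℕ.s≤s m≤n) = ≤-by (≤⇒nonNeg (·-mono-≤ m≤n))
    (solve 2 (λ x y → (:1 :+ y) :- (:1 :+ x) := y :- x) refl (m · 1#) (n · 1#))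

  1/suc : ℕ → R
  1/suc n = proj₁ (reciprocal (pos-· n))

  1/suc-pos : ∀ n → 0# < 1/suc n
  1/suc-pos n = proj₁ (proj₂ (reciprocal (pos-· n)))

  1/suc-→0 : ∀ {ε} → 0# < ε → ∃[ N ] (∀ n → N ℕ.≤ n → 1/suc n < ε)
  1/suc-→0 {ε} 0<ε =
    let r , 0<r , r*ε≈1 = reciprocal 0<ε
        N , r<N = archimedean r
    in N , λ n N≤n →
      let u , 0<u , u*n≈1 = reciprocal (pos-· n)
          r<1+n = <-≤-trans r<N (·-mono-≤ (ℕ.m≤n⇒m≤1+n N≤n))
      in <-by (*-pos (*-pos 0<u 0<ε) (<⇒pos r<1+n))
        (≈-by (zero-+ (zero-* ε (≈⇒zero (sym u*n≈1))) (zero-* u (≈⇒zero r*ε≈1)))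
          (solve 4 (λ ε u m r → u :* ε :* (m :- r) :- (ε :- u)
              := ε :* (u :* m :- :1) :+ u :* (:1 :- r :* ε)) refl ε u (suc n · 1#) r))

  ∑-zero : ∀ {n} (f : Vector R n) → (∀ i → f i ≈ 0#) → ∑ f ≈ 0#
  ∑-zero {n} f f≈0 = trans (sum-cong-≋ f≈0) (sum-replicate-zero n)

  ∑-nonNeg : ∀ {n} {f : Vector R n} → (∀ i → 0# ≤ f i) → 0# ≤ ∑ f
  ∑-nonNeg {zero}  _   = <-irrefl refl
  ∑-nonNeg {suc n} 0≤f = nonNeg-+ (0≤f zero) (∑-nonNeg (0≤f ∘ suc))

  term≤∑ : ∀ {n} {f : Vector R n} → (∀ i → 0# ≤ f i) → ∀ i → f i ≤ ∑ f
  term≤∑ {suc n} {f} 0≤f zero = ≤-by (∑-nonNeg (0≤f ∘ suc))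
    (solve 2 (λ x y → (x :+ y) :- x := y) refl (f zero) _)
  term≤∑ {suc n} {f} 0≤f (suc i) = ≤-by
    (nonNeg-+ (0≤f zero) (≤⇒nonNeg (term≤∑ (0≤f ∘ suc) i)))
    (solve 3 (λ x y z → (x :+ y) :- z := x :+ (y :- z)) refl (f zero) _ (f (suc i)))

  ∑-mono-≤ : ∀ {n} {f g : Vector R n} → (∀ i → f i ≤ g i) → ∑ f ≤ ∑ g
  ∑-mono-≤ {zero}  _ = <-irrefl refl
  ∑-mono-≤ {suc n} {f} {g} f≤g = ≤-by
    (nonNeg-+ (≤⇒nonNeg (f≤g zero)) (≤⇒nonNeg (∑-mono-≤ (f≤g ∘ suc))))
    (solve 4 (λ a b c d → (c :+ d) :- (a :+ b) := (c :- a) :+ (d :- b)) refl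
      (f zero) (∑ (f ∘ suc)) (g zero) (∑ (g ∘ suc)))

  ∑-distrib-- : ∀ {n} (f g : Vector R n) → ∑ (λ i → f i - g i) ≈ ∑ f - ∑ g
  ∑-distrib-- {zero}  f g = solve 0 (:0 := :0 :- :0) refl
  ∑-distrib-- {suc n} f g = trans (+-congˡ (∑-distrib-- (f ∘ suc) (g ∘ suc)))
    (solve 4 (λ a b c d → (a :- b) :+ (c :- d) := (a :+ c) :- (b :+ d)) refl
      (f zero) (g zero) (∑ (f ∘ suc)) (∑ (g ∘ suc)))

  -- Real numbers defined by cuts.

  module _ {p q : Level} {Lower : R → Set p} {Upper : R → Set q}
           (separated : ∀ {x y} → Lower x → Upper y → x < y) where

    Straddled : R → Set (c ⊔ ℓ₂ ⊔ p ⊔ q)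
    Straddled ε = ∃[ x ] ∃[ y ] Lower x × Upper y × y < x + ε

    -- The lower ends of brackets of width `1/suc n` form a Cauchy sequence: any lower point lies
    -- below the upper end of the n-th bracket, hence less than `1/suc n` above its lower end. The
    -- limit is described only by the points of both sets near it, as nothing tells on which side it
    -- falls.
    cut-point : (∀ {ε} → 0# < ε → Straddled ε) →
      ∃[ ρ ] (∀ {ε} → 0# < ε → ∃[ x ] ∃[ y ] Lower x × Upper y × ρ < x + ε × y < ρ + ε)
    cut-point straddled = ρ , near
      where
      bracket : ∀ n → Straddled (1/suc n)
      bracket n = straddled (1/suc-pos n)

      s : ℕ → R
      s n = proj₁ (bracket n)

      cauchy : Cauchy s
      cauchy ε 0<ε = let N , small = 1/suc-→0 0<ε in N , λ m n _ N≤n →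
        let _ , Lx , _ = proj₂ (bracket m)
            y , _ , Uy , y<sn+δ = proj₂ (bracket n)
        in <-trans (separated Lx Uy) (<-trans y<sn+δ (+-monoʳ-< (s n) (small n N≤n)))

      limit = complete s cauchy
      ρ = proj₁ limit

      near : ∀ {ε} → 0# < ε → ∃[ x ] ∃[ y ] Lower x × Upper y × ρ < x + ε × y < ρ + ε
      near {ε} 0<ε =
        let h , 0<h , h+h≈ε = halve 0<ε
            M , convergent = proj₂ limit h 0<h
            N , small = 1/suc-→0 0<h
            n = M ℕ.⊔ N
            sn<ρ+h , ρ<sn+h = convergent n (ℕ.m≤m⊔n M N)
            δ<h = small n (ℕ.m≤n⊔m M N)
            x , y , Lx , Uy , y<x+δ = bracket n
            h<ε = <-by {x = h} 0<h (trans (+-congʳ (sym h+h≈ε)) (solve 1 (λ h → (h :+ h) :- h := h) refl h))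
        in x , y , Lx , Uy , <-trans ρ<sn+h (+-monoʳ-< x h<ε) ,
          <-by (pos-+ (<⇒pos y<x+δ) (pos-+ (<⇒pos sn<ρ+h) (<⇒pos δ<h)))
            (trans (+-congʳ (+-congˡ (sym h+h≈ε)))
              (solve 5 (λ ρ h y x δ → (ρ :+ (h :+ h)) :- y :=
                  ((x :+ δ) :- y) :+ (((ρ :+ h) :- x) :+ (h :- δ))) refl ρ h y x (1/suc n)))

    module _ {a b : R} (La : Lower a) (Ub : Upper b)
             (located : ∀ {x y} → a ≤ x → x < y → y ≤ b → Lower x ⊎ Upper y) where

      straddled : ∀ {ε} → 0# < ε → Straddled ε
      straddled {ε} 0<ε =
        let h , 0<h , h+h≈ε = halve 0<ε
            δ , 0<δ , δ+δ≈h = halve 0<h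
            N , b-a<Nδ = archimedean-multiple (b - a) 0<δ
            4δ≈ε = trans (+-cong δ+δ≈h δ+δ≈h) h+h≈ε
        in march 0<δ 4δ≈ε N La (<-irrefl refl) (<-by (<⇒pos b-a<Nδ)
          (solve 3 (λ a b s → (a :+ s) :- b := s :- (b :- a)) refl a b (N · δ)))
        where
        -- Moves right from `a` in steps of a quarter of `ε`; the bound `b < x + N · δ` makes it
        -- end. Cotransitivity compares `b` with `x + δ + δ` and `x + δ + δ + δ`. If `b` is below
        -- the latter, `b` itself closes the bracket. Otherwise both `x + δ` and `x + δ + δ` are at
        -- most `b`, and `located` either moves the lower end to the first or closes the bracket
        -- with the second.
        march : ∀ {δ} → 0# < δ → (δ + δ) + (δ + δ) ≈ ε → ∀ N {x} →
          Lower x → a ≤ x → b < x + N · δ → Straddled ε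
        march _ _ zero {x} Lx _ b<x+0 =
          contradiction (<-respʳ-≈ (+-identityʳ x) b<x+0) (<-asym (separated Lx Ub))
        march {δ} 0<δ 4δ≈ε (suc N) {x} Lx a≤x b<x+Nδ =
          [ (λ x+2δ<b → [ advance , stop (<-trans (<-+ˡ 0<δ) (<-+ˡ 0<δ)) ]′
              (located a≤x+δ (<-+ˡ 0<δ) (<-asym x+2δ<b)))
          , (λ b<x+3δ → stop (<-trans b<x+3δ (<-+ˡ 0<δ)) Ub)
          ]′ (<-cotrans (<-+ˡ {x + δ + δ} 0<δ) b)
          where

          <-+ˡ : ∀ {x y} → 0# < y → x < x + y
          <-+ˡ {x} {y} 0<y = <-by 0<y (solve 2 (λ x y → (x :+ y) :- x := y) refl x y)

          x+4δ≈x+ε : x + δ + δ + δ + δ ≈ x + ε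
          x+4δ≈x+ε = trans
            (solve 2 (λ x δ → x :+ δ :+ δ :+ δ :+ δ := x :+ ((δ :+ δ) :+ (δ :+ δ))) refl x δ)
            (+-congˡ 4δ≈ε)

          stop : ∀ {y} → y < x + δ + δ + δ + δ → Upper y → Straddled ε
          stop y<x+4δ Uy = x , _ , Lx , Uy , <-respʳ-≈ x+4δ≈x+ε y<x+4δ

          a≤x+δ : a ≤ x + δ
          a≤x+δ x+δ<a = a≤x (<-trans (<-+ˡ 0<δ) x+δ<a)

          advance : Lower (x + δ) → Straddled ε
          advance Lx+δ = march 0<δ 4δ≈ε N Lx+δ a≤x+δ
            (<-respʳ-≈ (sym (+-assoc x δ (N · δ))) b<x+Nδ)

-- The secular equation and its roots.

module SecularEquation {c ℓ₁ ℓ₂ : Level} (ℝ : RealNumbers c ℓ₁ ℓ₂)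
  {p : ℕ} (d : Fin p → RealNumbers.Carrier ℝ)
  (d-pos : ∀ i → RealNumbers._<_ ℝ (RealNumbers.0# ℝ) (d i)) where
  open RealProperties ℝ

  -- A relation instead of a function of `x`, since the inverses exist only away from the poles and
  -- would otherwise depend on proofs of apartness.
  Inverses : R → Vector R p → Set ℓ₁
  Inverses x v = ∀ i → v i * (x - d i) ≈ 1#

  -- ∑ dᵢ / (x - dᵢ), when v lists the inverses of the x - dᵢ.
  secular : Vector R p → R
  secular v = ∑ λ i → d i * v i

  IsRoot : R → Set (c ⊔ ℓ₁)
  IsRoot x = ∃[ v ] Inverses x v × secular v ≈ 1#

  inverses : ∀ {x} → (∀ i → x # d i) → ∃[ v ] Inverses x v
  inverses x#d = (λ i → proj₁ (inverse (x#d i))) , λ i → proj₂ (inverse (x#d i))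

  -- The difference quotient of the secular function between two points, up to sign:
  -- `1/(x - d) - 1/(y - d)` equals `(y - x) / ((x - d) (y - d))`.
  slope : Vector R p → Vector R p → R
  slope v w = ∑ λ i → d i * (v i * w i)

  inverse-difference : ∀ {x y v w e} → v * (x - e) ≈ 1# → w * (y - e) ≈ 1# →
    v - w ≈ (y - x) * (v * w)
  inverse-difference {x} {y} {v} {w} {e} vx wy = ≈-by
    (zero-+ (zero-* v (≈⇒zero (sym wy))) (zero-* (- w) (≈⇒zero (sym vx))))
    (solve 5 (λ x y v w e → (y :- x) :* (v :* w) :- (v :- w) :=
      v :* (w :* (y :- e) :- :1) :+ (:- w) :* (v :* (x :- e) :- :1)) refl x y v w e)

  secular-difference : ∀ {x y v w} → Inverses x v → Inverses y w →
    secular v - secular w ≈ (y - x) * slope v w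
  secular-difference {x} {y} {v} {w} vx wy = trans
    (sym (∑-distrib-- (λ i → d i * v i) (λ i → d i * w i)))
    (trans
      (sum-cong-≋ λ i → trans
        (solve 3 (λ d v w → d :* v :- d :* w := d :* (v :- w)) refl (d i) (v i) (w i))
        (trans (*-congˡ (inverse-difference (vx i) (wy i)))
          (solve 4 (λ d t v w → d :* (t :* (v :* w)) := t :* (d :* (v :* w))) refl (d i) (y - x) (v i) (w i))))
      (sym (*-distribˡ-sum (y - x) (λ i → d i * (v i * w i)))))

  SameSigns : Vector R p → Vector R p → Set ℓ₂
  SameSigns v w = ∀ i → 0# < v i * w i

  -- Equal signs mean that no pole separates the two points. The index witnesses that the sum has a
  -- term, without which it would only be nonnegative.
  slope-pos : ∀ {v w} → Fin p → SameSigns v w → 0# < slope v w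
  slope-pos i vw = <-≤-trans (*-pos (d-pos i) (vw i))
    (term≤∑ (λ j → <-asym (*-pos (d-pos j) (vw j))) i)

  secular-reflects-< : ∀ {x y v w} → Fin p → SameSigns v w →
    Inverses x v → Inverses y w → secular w < secular v → x < y
  secular-reflects-< i vw vx wy Sw<Sv = <-by
    (pos-cancelʳ (<-respʳ-≈ (secular-difference vx wy) (<⇒pos Sw<Sv)) (slope-pos i vw)) refl

  secular-anti-mono : ∀ {x y v w} → Fin p → SameSigns v w →
    Inverses x v → Inverses y w → x < y → secular w < secular v
  secular-anti-mono i vw vx wy x<y =
    <-by (*-pos (<⇒pos x<y) (slope-pos i vw)) (secular-difference vx wy)

  root-unique : ∀ {x y v w} → Fin p → SameSigns v w →
    Inverses x v → Inverses y w → secular v ≈ 1# → secular w ≈ 1# → x ≈ y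
  root-unique i vw vx wy Sv≈1 Sw≈1 = ≤-antisym
    (λ y<x → <-irrefl (trans Sv≈1 (sym Sw≈1)) (secular-anti-mono i wv wy vx y<x))
    (λ x<y → <-irrefl (trans Sw≈1 (sym Sv≈1)) (secular-anti-mono i vw vx wy x<y))
    where
    wv = λ j → <-respʳ-≈ (*-comm _ _) (vw j)

  pos-right : ∀ {v x e} → v * (x - e) ≈ 1# → e < x → 0# < v
  pos-right vx e<x = inverse-pos vx (<⇒pos e<x)

  neg-inverse : ∀ {v x e} → v * (x - e) ≈ 1# → - v * (e - x) ≈ 1#
  neg-inverse {v} {x} {e} vx =
    trans (solve 3 (λ v x e → (:- v) :* (e :- x) := v :* (x :- e)) refl v x e) vx

  pos-left : ∀ {v x e} → v * (x - e) ≈ 1# → x < e → 0# < - v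
  pos-left vx x<e = inverse-pos (neg-inverse vx) (<⇒pos x<e)

  neg-*-neg : ∀ {v w} → 0# < - v → 0# < - w → 0# < v * w
  neg-*-neg {v} {w} 0<-v 0<-w =
    <-respʳ-≈ (solve 2 (λ v w → (:- v) :* (:- w) := v :* w) refl v w) (*-pos 0<-v 0<-w)

  -- Since `u * x ≈ 1#`, the difference `b - u` is `u * (b * x - 1#)`, and `b * x` is at least
  -- `b * y`.
  inverse-≤ : ∀ {u x b y} → u * x ≈ 1# → 0# ≤ u → 0# ≤ b → 1# ≤ b * y → y ≤ x → u ≤ b
  inverse-≤ {u} {x} {b} {y} ux 0≤u 0≤b 1≤by y≤x = ≤-by
    (nonNeg-* 0≤u (nonNeg-+ (nonNeg-* 0≤b (≤⇒nonNeg y≤x)) (≤⇒nonNeg 1≤by)))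
    (≈-by (zero-* b (≈⇒zero (sym ux)))
      (solve 4 (λ u x b y → u :* (b :* (x :- y) :+ (b :* y :- :1)) :- (b :- u)
        := b :* (u :* x :- :1)) refl u x b y))

  total : R
  total = ∑ d

  -- Used with z = v to the right of a pole, and with z = - v to the left of one.
  dominant-term : ∀ {b} (z : Vector R p) → 0# < b → (∀ i → 0# ≤ z i + b) →
    ∀ i → 1# + b * total < d i * z i → 1# < secular z
  dominant-term {b} z 0<b 0≤z+b i large = <-by
    (pos-+-nonNeg (pos-+ (<⇒pos large) (*-pos (d-pos i) 0<b)) (≤⇒nonNeg
      (term≤∑ (λ j → nonNeg-* (<-asym (d-pos j)) (0≤z+b j)) i)))
    (trans (solve 6 (λ s b t x z u → s :- :1 :=
          ((x :* z :- (:1 :+ b :* t)) :+ x :* b) :+ ((s :+ b :* t) :- x :* (z :+ b)))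
        refl (secular z) b total (d i) (z i) b)
      (+-congˡ (+-congʳ (sym shifted))))
    where
    shifted : ∑ (λ j → d j * (z j + b)) ≈ secular z + b * total
    shifted = trans
      (sum-cong-≋ λ j → solve 3 (λ x z b → x :* (z :+ b) := x :* z :+ b :* x) refl (d j) (z j) b)
      (trans (∑-distrib-+ (λ j → d j * z j) (λ j → b * d j))
        (+-congˡ (sym (*-distribˡ-sum b d))))

  -- A distance `t` from a pole of weight `e` at which its term prevails. Poles across the gap are
  -- at distance at least `gap - t`, so by `remainder` their inverses are at most `b` in absolute
  -- value and all terms together lose at most `b * total`. By `large`, the term `e * T` outweighs
  -- this loss by more than 1.
  record Offset (gap e : R) : Set (c ⊔ ℓ₁ ⊔ ℓ₂) where
    field
      t T b     : R
      0<t       : 0# < t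
      0<b       : 0# < b
      T*t≈1     : T * t ≈ 1#
      remainder : 1# < b * (gap - t)
      large     : 1# + b * total < e * T

    t<gap : t < gap
    t<gap = <-by
      (pos-cancelʳ (<-respʳ-≈ (*-comm _ _) (<-trans 0<1 remainder)) 0<b) refl

  offset : ∀ {gap e} → Fin p → 0# < gap → 0# < e → Offset gap e
  offset {gap} {e} i 0<g 0<e =
    let G , 0<G , Gg = reciprocal 0<g
        h , 0<h , he = reciprocal 0<e
        -- Twice `1 / gap`, so that `b * (gap - t)` is `2 - b * t` and exceeds 1 as soon as `b * t`
        -- is below 1.
        b = G + G
        0<b = pos-+ 0<G 0<G
        m = 1# + b * total
        0<m = pos-+ 0<1 (*-pos 0<b 0<total)
        -- The summand `m * h` gives `e * T` the required `m`, with `e * b` to spare; the summand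
        -- `b` turns `t * T ≈ 1#` into `1 - b * t = m * h * t`, which is positive.
        T = b + m * h
        0<T = pos-+ 0<b (*-pos 0<m 0<h)
        t , 0<t , tT = reciprocal 0<T
    in record
      { t = t ; T = T ; b = b ; 0<t = 0<t ; 0<b = 0<b
      ; T*t≈1 = trans (*-comm T t) tT
      ; remainder = <-by (*-pos (*-pos 0<m 0<h) 0<t) (≈-by
          (zero-+ (zero-* (1# + 1#) (≈⇒zero Gg)) (zero-* 1# (≈⇒zero (sym tT))))
          (solve 5 (λ G g t m h →
              m :* h :* t :- ((G :+ G) :* (g :- t) :- :1)
              := (:1 :+ :1) :* (:1 :- G :* g) :+ :1 :* (t :* ((G :+ G) :+ m :* h) :- :1))
            refl G gap t m h))
      ; large = <-by (*-pos 0<e 0<b) (≈-by (zero-* m (≈⇒zero he))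
          (solve 4 (λ e b m h → e :* b :- (e :* (b :+ m :* h) :- m) := m :* (:1 :- h :* e))
            refl e b m h))
      }
    where
    0<total = <-≤-trans (d-pos i) (term≤∑ (λ j → <-asym (d-pos j)) i)

  unique-inverse : ∀ {u x w} → u * x ≈ 1# → w * x ≈ 1# → u ≈ w
  unique-inverse {u} {x} {w} ux wx = ≈-by
    (zero-+ (zero-* w (≈⇒zero ux)) (zero-* (- u) (≈⇒zero wx)))
    (solve 3 (λ u x w → w :- u := w :* (:1 :- u :* x) :+ (:- u) :* (:1 :- w :* x)) refl u x w)

  -- The secular function on an interval without poles.

  module Gap {lo hi : R} (lo<hi : lo < hi) (sides : ∀ i → d i ≤ lo ⊎ hi ≤ d i) where

    avoids-poles : ∀ {x} → lo < x → x < hi → ∀ i → x # d i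
    avoids-poles lo<x x<hi i =
      [ (λ d≤lo → >⇒# (≤-<-trans d≤lo lo<x)) , (λ hi≤d → <⇒# (<-≤-trans x<hi hi≤d)) ]′ (sides i)

    same-signs : ∀ {x y v w} → lo < x → x < hi → lo < y → y < hi →
      Inverses x v → Inverses y w → SameSigns v w
    same-signs lo<x x<hi lo<y y<hi vx wy i =
      [ (λ d≤lo → *-pos (pos-right (vx i) (≤-<-trans d≤lo lo<x)) (pos-right (wy i) (≤-<-trans d≤lo lo<y)))
      , (λ hi≤d → neg-*-neg (pos-left (vx i) (<-≤-trans x<hi hi≤d)) (pos-left (wy i) (<-≤-trans y<hi hi≤d)))
      ]′ (sides i)

    -- At `lo + t` the poles up to `lo` have positive inverses and those from `hi` on have inverses
    -- of at least `- b`, so the term of the pole at `lo` decides.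
    right-of-pole : ∀ i → d i ≈ lo → ∃[ a ] ∃[ v ] lo < a × a < hi × Inverses a v × 1# < secular v
    right-of-pole i di≈lo = a , v , lo<a , a<hi , va ,
      dominant-term v 0<b bounded i (<-respʳ-≈ (*-congˡ T≈vi) large)
      where
      open Offset (offset i (<⇒pos lo<hi) (d-pos i))

      a = lo + t

      lo<a : lo < a
      lo<a = <-by 0<t (solve 2 (λ x y → (x :+ y) :- x := y) refl lo t)

      a<hi : a < hi
      a<hi = <-by (<⇒pos t<gap)
        (solve 3 (λ x y t → y :- (x :+ t) := (y :- x) :- t) refl lo hi t)

      v = proj₁ (inverses (avoids-poles lo<a a<hi))
      va = proj₂ (inverses (avoids-poles lo<a a<hi))

      T≈vi : T ≈ v i
      T≈vi = unique-inverse T*t≈1 (trans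
        (*-congˡ (sym (trans (+-congˡ (-‿cong di≈lo)) (solve 2 (λ x y → (x :+ y) :- x := y) refl lo t))))
        (va i))

      bounded : ∀ j → 0# ≤ v j + b
      bounded j =
        [ (λ d≤lo → nonNeg-+ (<-asym (pos-right (va j) (≤-<-trans d≤lo lo<a))) (<-asym 0<b))
        , (λ hi≤d → λ vj+b<0 → inverse-≤ (neg-inverse (va j)) (<-asym (pos-left (va j) (<-≤-trans a<hi hi≤d)))
            (<-asym 0<b) (<-asym remainder)
            (≤-by (≤⇒nonNeg hi≤d)
              (solve 4 (λ x y t e → (e :- (x :+ t)) :- (y :- x :- t) := e :- y) refl lo hi t (d j)))
            (<-by (<⇒pos vj+b<0) (solve 2 (λ v b → (:- v) :- b := :0 :- (v :+ b)) refl (v j) b)))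
        ]′ (sides j)

    -- The mirror image, with the negated inverses in the role of the dominant terms. It even yields
    -- a value below -1, whence the summand 2 in the difference to 1.
    left-of-pole : ∀ i → d i ≈ hi → ∃[ b ] ∃[ v ] lo < b × b < hi × Inverses b v × secular v < 1#
    left-of-pole i di≈hi = a , v , lo<a , a<hi , va ,
      <-by (pos-+ (pos-+ 0<1 0<1) (<⇒pos (dominant-term (λ j → - v j) 0<b bounded i (<-respʳ-≈ (*-congˡ T≈-vi) large))))
        (≈-by (≈⇒zero negated) (solve 2 (λ s z →
          ((:1 :+ :1) :+ (z :- :1)) :- (:1 :- s) := z :- (:0 :- s)) refl (secular v) (secular (λ j → - v j))))
      where
      open Offset (offset i (<⇒pos lo<hi) (d-pos i))

      a = hi - t

      lo<a : lo < a
      lo<a = <-by (<⇒pos t<gap)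
        (solve 3 (λ x y t → (y :- t) :- x := (y :- x) :- t) refl lo hi t)

      a<hi : a < hi
      a<hi = <-by 0<t (solve 2 (λ x y → x :- (x :- y) := y) refl hi t)

      v = proj₁ (inverses (avoids-poles lo<a a<hi))
      va = proj₂ (inverses (avoids-poles lo<a a<hi))

      T≈-vi : T ≈ - v i
      T≈-vi = unique-inverse T*t≈1 (trans
        (*-congˡ (sym (trans (+-congʳ di≈hi) (solve 2 (λ x y → x :- (x :- y) := y) refl hi t))))
        (neg-inverse (va i)))

      bounded : ∀ j → 0# ≤ - v j + b
      bounded j =
        [ (λ d≤lo → λ b-vj<0 → inverse-≤ (va j) (<-asym (pos-right (va j) (≤-<-trans d≤lo lo<a)))
            (<-asym 0<b) (<-asym remainder)
            (≤-by (≤⇒nonNeg d≤lo)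
              (solve 4 (λ x y t e → ((y :- t) :- e) :- (y :- x :- t) := x :- e) refl lo hi t (d j)))
            (<-by (<⇒pos b-vj<0) (solve 2 (λ v b → v :- b := :0 :- (:- v :+ b)) refl (v j) b)))
        , (λ hi≤d → nonNeg-+ (<-asym (pos-left (va j) (<-≤-trans a<hi hi≤d))) (<-asym 0<b))
        ]′ (sides j)

      negated : 0# - secular v ≈ secular (λ j → - v j)
      negated = trans (solve 1 (λ s → :0 :- s := (:- :1) :* s) refl (secular v))
        (trans (*-distribˡ-sum (- 1#) (λ j → d j * v j))
          (sum-cong-≋ λ j → solve 2 (λ x v → (:- :1) :* (x :* v) := x :* (:- v)) refl (d j) (v j)))

    module _ {a b : R} {α β : Vector R p} (i₀ : Fin p)
             (lo<a : lo < a) (b<hi : b < hi) (αa : Inverses a α) (βb : Inverses b β)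
             (Sα>1 : 1# < secular α) (Sβ<1 : secular β < 1#) (lo<b : lo < b) (a<hi : a < hi) where

      Between : R → Set ℓ₂
      Between x = a ≤ x × x ≤ b

      lo<between : ∀ {x} → Between x → lo < x
      lo<between (a≤x , _) = <-≤-trans lo<a a≤x

      between<hi : ∀ {x} → Between x → x < hi
      between<hi (_ , x≤b) = ≤-<-trans x≤b b<hi

      inverses-between : ∀ {x} → Between x → ∃[ v ] Inverses x v
      inverses-between x∈ = inverses (avoids-poles (lo<between x∈) (between<hi x∈))

      same-signs-between : ∀ {x y v w} → Between x → Between y →
        Inverses x v → Inverses y w → SameSigns v w
      same-signs-between x∈ y∈ =
        same-signs (lo<between x∈) (between<hi x∈) (lo<between y∈) (between<hi y∈)

      Lower Upper : R → Set (c ⊔ ℓ₁ ⊔ ℓ₂)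
      Lower x = Between x × ∃[ v ] Inverses x v × 1# < secular v
      Upper x = Between x × ∃[ v ] Inverses x v × secular v < 1#

      separated : ∀ {x y} → Lower x → Upper y → x < y
      separated (x∈ , v , vx , 1<Sv) (y∈ , w , wy , Sw<1) =
        secular-reflects-< i₀ (same-signs-between x∈ y∈ vx wy) vx wy (<-trans Sw<1 1<Sv)

      a<b : a < b
      a<b = secular-reflects-< i₀ (same-signs lo<a a<hi lo<b b<hi αa βb) αa βb (<-trans Sβ<1 Sα>1)

      -- The values at `x` and `y` differ strictly, so cotransitivity places 1 above the smaller or
      -- below the larger one. At a single point this comparison could not be decided.
      located : ∀ {x y} → a ≤ x → x < y → y ≤ b → Lower x ⊎ Upper y
      located a≤x x<y y≤b =
        let x∈ = a≤x , λ b<x → y≤b (<-trans b<x x<y)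
            y∈ = (λ y<a → a≤x (<-trans x<y y<a)) , y≤b
            v , vx = inverses-between x∈
            w , wy = inverses-between y∈
            Sw<Sv = secular-anti-mono i₀ (same-signs-between x∈ y∈ vx wy) vx wy x<y
        in [ (λ Sw<1 → inj₂ (y∈ , w , wy , Sw<1)) , (λ 1<Sv → inj₁ (x∈ , v , vx , 1<Sv)) ]′
             (<-cotrans Sw<Sv 1#)

      -- A Lipschitz constant on the interval from `a` to `b`. Inverses of poles on the left are
      -- positive and largest at `a`; those of poles on the right are negative and of largest
      -- absolute value at `b`. The sum of both squares serves either side, and the 1 makes the
      -- bound strict.
      slope-bound : R
      slope-bound = 1# + ∑ λ i → d i * (α i * α i + β i * β i)

      product-≤ : ∀ {u w s} → 0# ≤ s → 0# ≤ w → u ≤ s → w ≤ s → u * w ≤ s * s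
      product-≤ {u} {w} {s} 0≤s 0≤w u≤s w≤s = ≤-by
        (nonNeg-+ (nonNeg-* 0≤s (≤⇒nonNeg w≤s)) (nonNeg-* 0≤w (≤⇒nonNeg u≤s)))
        (solve 3 (λ u w s → s :* s :- u :* w := s :* (s :- w) :+ w :* (s :- u)) refl u w s)

      square-nonNeg : ∀ x → 0# ≤ x * x
      square-nonNeg x xx<0 = ¬¬-trichotomous 0# x λ where
        (inj₁ 0<x) → <-asym (*-pos 0<x 0<x) xx<0
        (inj₂ (inj₁ 0≈x)) → <-irrefl (trans (*-congʳ (sym 0≈x)) (zeroˡ x)) xx<0
        (inj₂ (inj₂ x<0)) → <-asym (*-pos (<⇒pos x<0) (<⇒pos x<0)) (<-respˡ-≈
          (solve 1 (λ x → x :* x := (:0 :- x) :* (:0 :- x)) refl x) xx<0)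

      α-bound : ∀ {x v i} → Between x → Inverses x v → d i ≤ lo → v i ≤ α i
      α-bound {x} {v} {i} x∈@(a≤x , _) vx d≤lo = ≤-by
        (nonNeg-* (≤⇒nonNeg a≤x) (<-asym (*-pos
          (pos-right (αa i) (≤-<-trans d≤lo lo<a)) (pos-right (vx i) (≤-<-trans d≤lo (lo<between x∈))))))
        (inverse-difference (αa i) (vx i))

      β-bound : ∀ {x v i} → Between x → Inverses x v → hi ≤ d i → - v i ≤ - β i
      β-bound {x} {v} {i} x∈@(_ , x≤b) vx hi≤d = ≤-by
        (nonNeg-* (≤⇒nonNeg x≤b) (<-asym (neg-*-neg
          (pos-left (vx i) (<-≤-trans (between<hi x∈) hi≤d)) (pos-left (βb i) (<-≤-trans b<hi hi≤d)))))
        (trans (solve 2 (λ v β → (:- β) :- (:- v) := v :- β) refl (v i) (β i))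
          (inverse-difference (vx i) (βb i)))

      slope<bound : ∀ {x y v w} → Between x → Between y → Inverses x v → Inverses y w →
        slope v w < slope-bound
      slope<bound {x} {y} {v} {w} x∈ y∈ vx wy = <-by
        (pos-+-nonNeg 0<1 (≤⇒nonNeg (∑-mono-≤ λ i → ≤-by
          (nonNeg-* (<-asym (d-pos i)) (≤⇒nonNeg (product-bound i)))
          (solve 3 (λ d s t → d :* s :- d :* t := d :* (s :- t)) refl (d i) _ (v i * w i)))))
        (solve 2 (λ s t → (:1 :+ s) :- t := :1 :+ (s :- t)) refl
          (∑ λ i → d i * (α i * α i + β i * β i)) (slope v w))
        where
        product-bound : ∀ i → v i * w i ≤ α i * α i + β i * β i
        product-bound i =
          [ (λ d≤lo → ≤-by
              (nonNeg-+ (≤⇒nonNeg (product-≤ (<-asym (pos-right (αa i) (≤-<-trans d≤lo lo<a)))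
                  (<-asym (pos-right (wy i) (≤-<-trans d≤lo (lo<between y∈))))
                  (α-bound x∈ vx d≤lo) (α-bound y∈ wy d≤lo)))
                (square-nonNeg (β i)))
              (solve 4 (λ v w α β → (α :* α :+ β :* β) :- v :* w := (α :* α :- v :* w) :+ β :* β)
                refl (v i) (w i) (α i) (β i)))
          , (λ hi≤d → ≤-by
              (nonNeg-+ (≤⇒nonNeg (product-≤ (<-asym (pos-left (βb i) (<-≤-trans b<hi hi≤d)))
                  (<-asym (pos-left (wy i) (<-≤-trans (between<hi y∈) hi≤d)))
                  (β-bound x∈ vx hi≤d) (β-bound y∈ wy hi≤d)))
                (square-nonNeg (α i)))
              (solve 4 (λ v w α β → (α :* α :+ β :* β) :- v :* w
                  := ((:- β) :* (:- β) :- (:- v) :* (:- w)) :+ α :* α)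
                refl (v i) (w i) (α i) (β i)))
          ]′ (sides i)

      -- Only an upper bound on `y - x` enters because the slope is positive. This is the one-sided
      -- form in which the cut supplies its approximations.
      secular-lipschitz : ∀ {x y v w ε} → Between x → Between y → Inverses x v → Inverses y w →
        0# < ε → y < x + ε → secular v - secular w < ε * slope-bound
      secular-lipschitz {x} {y} {v} {w} {ε} x∈ y∈ vx wy 0<ε y<x+ε = <-by
        (pos-+ (*-pos (<⇒pos y<x+ε) (slope-pos i₀ (same-signs-between x∈ y∈ vx wy)))
          (*-pos 0<ε (<⇒pos (slope<bound x∈ y∈ vx wy))))
        (trans (+-congˡ (-‿cong (secular-difference vx wy)))
          (solve 5 (λ ε m x y k → ε :* m :- (y :- x) :* k := ((x :+ ε) :- y) :* k :+ ε :* (m :- k))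
            refl ε slope-bound x y (slope v w)))

      root-between : ∃[ ρ ] lo < ρ × ρ < hi × IsRoot ρ
      root-between = ρ , lo<between ρ∈ , between<hi ρ∈ , r , rρ , ≤-antisym Sr≤1 Sr≥1
        where
        cut = cut-point separated (straddled separated
          ((<-irrefl refl , <-asym a<b) , α , αa , Sα>1)
          ((<-asym a<b , <-irrefl refl) , β , βb , Sβ<1) located)
        ρ = proj₁ cut

        near : ∀ {ε} → 0# < ε → ∃[ x ] ∃[ y ] Lower x × Upper y × ρ < x + ε × y < ρ + ε
        near = proj₂ cut

        ρ∈ : Between ρ
        ρ∈ =
          (λ ρ<a → let x , y , Lx , ((a≤y , _) , _) , _ , y<a = near (<⇒pos ρ<a) in
            a≤y (<-respʳ-≈ (solve 2 (λ ρ a → ρ :+ (a :- ρ) := a) refl ρ a) y<a)) ,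
          (λ b<ρ → let x , y , ((_ , x≤b) , _) , Uy , ρ<x+ε , _ = near (<⇒pos b<ρ) in
            x≤b (<-by (<⇒pos ρ<x+ε)
              (solve 3 (λ ρ b x → x :- b := (x :+ (ρ :- b)) :- ρ) refl ρ b x)))

        r = proj₁ (inverses-between ρ∈)
        rρ = proj₂ (inverses-between ρ∈)

        0<bound : 0# < slope-bound
        0<bound = <-trans (slope-pos i₀ (same-signs-between ρ∈ ρ∈ rρ rρ)) (slope<bound ρ∈ ρ∈ rρ rρ)

        modulus : ∀ {η} → 0# < η → ∃[ ε ] 0# < ε × ε * slope-bound ≈ η
        modulus {η} 0<η = let m , 0<m , mk = reciprocal 0<bound in
          η * m , *-pos 0<η 0<m , trans (*-assoc _ _ _) (trans (*-congˡ mk) (*-identityʳ η))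

        Sr≤1 : secular r ≤ 1#
        Sr≤1 1<Sr =
          -- With `ε` equal to the excess over 1 divided by the Lipschitz constant, the upper point
          -- `y` near `ρ` would still have a value above 1.
          let ε , 0<ε , εM≈η = modulus (<⇒pos 1<Sr)
              x , y , Lx , (y∈ , w , wy , Sw<1) , _ , y<ρ+ε = near 0<ε
          in <-asym Sw<1 (<-by
            (<⇒pos (<-respʳ-≈ εM≈η (secular-lipschitz ρ∈ y∈ rρ wy 0<ε y<ρ+ε)))
            (solve 2 (λ r w → w :- :1 := (r :- :1) :- (r :- w)) refl (secular r) (secular w)))

        Sr≥1 : 1# ≤ secular r
        Sr≥1 Sr<1 =
          let ε , 0<ε , εM≈η = modulus (<⇒pos Sr<1)
              x , y , (x∈ , v , vx , 1<Sv) , Uy , ρ<x+ε , _ = near 0<ε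
          in <-asym 1<Sv (<-by
            (<⇒pos (<-respʳ-≈ εM≈η (secular-lipschitz x∈ ρ∈ vx rρ 0<ε ρ<x+ε)))
            (solve 2 (λ r v → :1 :- v := (:1 :- r) :- (v :- r)) refl (secular r) (secular v)))

  root-in-gap : ∀ {lo hi} → lo < hi → (∀ i → d i ≤ lo ⊎ hi ≤ d i) →
    ∀ {i j} → d i ≈ lo → d j ≈ hi → ∃[ ρ ] lo < ρ × ρ < hi × IsRoot ρ
  root-in-gap lo<hi sides {i} {j} di≈lo dj≈hi =
    let a , α , lo<a , a<hi , αa , 1<Sα = right-of-pole i di≈lo
        b , β , lo<b , b<hi , βb , Sβ<1 = left-of-pole j dj≈hi
    in root-between i lo<a b<hi αa βb 1<Sα Sβ<1 lo<b a<hi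
    where open Gap lo<hi sides

  -- At `lo + (total + 1#)` every inverse is at most `1 / (total + 1)`, so the secular function is
  -- at most `total / (total + 1)`. The gap is given an artificial right end one unit further, at
  -- which there is no pole.
  root-beyond : ∀ {lo} → (∀ i → d i ≤ lo) → ∀ {i} → d i ≈ lo → ∃[ ρ ] lo < ρ × IsRoot ρ
  root-beyond {lo} d≤lo {i} di≈lo =
    let a , α , lo<a , a<hi , αa , 1<Sα = right-of-pole i di≈lo
        ρ , lo<ρ , _ , root = root-between i lo<a b<hi αa βb 1<Sα Sβ<1 lo<b a<hi
    in ρ , lo<ρ , root
    where
    0<total : 0# < total
    0<total = <-≤-trans (d-pos i) (term≤∑ (λ j → <-asym (d-pos j)) i)

    0<total+1 = pos-+ 0<total 0<1

    b = lo + (total + 1#)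

    lo<b : lo < b
    lo<b = <-by 0<total+1 (solve 2 (λ x y → (x :+ y) :- x := y) refl lo (total + 1#))

    b<hi : b < b + 1#
    b<hi = <-by 0<1 (solve 1 (λ b → (b :+ :1) :- b := :1) refl b)

    open Gap (<-trans lo<b b<hi) (λ j → inj₁ (d≤lo j))

    β = proj₁ (inverses (avoids-poles lo<b b<hi))
    βb = proj₂ (inverses (avoids-poles lo<b b<hi))

    Sβ<1 : secular β < 1#
    Sβ<1 =
      let m , 0<m , mD = reciprocal 0<total+1
          β≤m : ∀ j → β j ≤ m
          β≤m j = inverse-≤ (βb j) (<-asym (pos-right (βb j) (≤-<-trans (d≤lo j) lo<b)))
            (<-asym 0<m) (≈⇒≤ (sym mD)) (≤-by (≤⇒nonNeg (d≤lo j))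
              (solve 3 (λ x y e → ((x :+ y) :- e) :- y := x :- e) refl lo (total + 1#) (d j)))
      in ≤-<-trans
        (∑-mono-≤ {g = λ j → d j * m} λ j → ≤-by (nonNeg-* (<-asym (d-pos j)) (≤⇒nonNeg (β≤m j)))
          (solve 3 (λ d b m → d :* m :- d :* b := d :* (m :- b)) refl (d j) (β j) m))
        (<-respˡ-≈ (*-distribʳ-sum m d) (<-by 0<m (≈-by (zero-* (- 1#) (≈⇒zero mD))
          (solve 2 (λ t m → m :- (:1 :- t :* m) := (:- :1) :* (:1 :- m :* (t :+ :1))) refl total m))))

-- Vectors supported on the leaves of one weight.

module Occurrences {c ℓ₁ ℓ₂ : Level} (ℝ : RealNumbers c ℓ₁ ℓ₂) where
  open RealProperties ℝ
  open Spectrum ℝ using (combination)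

  -- Besides the count, this holds a decision at each position between equality and apartness. The
  -- recursions below act on it, as the field provides no test.
  data Occurs (e : R) : ∀ {p} → ℕ → Vector R p → Set (c ⊔ ℓ₁ ⊔ ℓ₂) where
    done : {d : Vector R 0} → Occurs e 0 d
    keep : ∀ {p k} {d : Vector R (suc p)} → d zero ≈ e → Occurs e k (d ∘ suc) → Occurs e (suc k) d
    skip : ∀ {p k} {d : Vector R (suc p)} → d zero # e → Occurs e k (d ∘ suc) → Occurs e k d

  occurs-at : ∀ {e p k} {d : Vector R p} → Occurs e (suc k) d → ∃[ i ] d i ≈ e
  occurs-at (keep d≈e _) = zero , d≈e
  occurs-at (skip _ o)   = let i , d≈e = occurs-at o in suc i , d≈e

  extend : ∀ {e p k} {d : Vector R p} → Occurs e k d → Vector R k → Vector R p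
  extend (keep _ o) w zero    = w zero
  extend (keep _ o) w (suc i) = extend o (w ∘ suc) i
  extend (skip _ o) w zero    = 0#
  extend (skip _ o) w (suc i) = extend o w i

  restrict : ∀ {e p k} {d : Vector R p} → Occurs e k d → Vector R p → Vector R k
  restrict (keep _ o) v zero    = v zero
  restrict (keep _ o) v (suc l) = restrict o (v ∘ suc) l
  restrict (skip _ o) v l       = restrict o (v ∘ suc) l

  ∑-extend : ∀ {e p k} {d : Vector R p} (o : Occurs e k d) w → ∑ (extend o w) ≈ ∑ w
  ∑-extend done       w = refl
  ∑-extend (keep _ o) w = +-congˡ (∑-extend o (w ∘ suc))
  ∑-extend (skip _ o) w = trans (+-identityˡ _) (∑-extend o w)

  extend-supported : ∀ {e p k} {d : Vector R p} (o : Occurs e k d) w i →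
    d i * extend o w i ≈ e * extend o w i
  extend-supported (keep d≈e _) w zero    = *-congʳ d≈e
  extend-supported (keep _ o)   w (suc i) = extend-supported o (w ∘ suc) i
  extend-supported (skip _ _)   w zero    = trans (zeroʳ _) (sym (zeroʳ _))
  extend-supported (skip _ o)   w (suc i) = extend-supported o w i

  extend-restrict : ∀ {e p k} {d : Vector R p} (o : Occurs e k d) {v} →
    (∀ i → d i # e → v i ≈ 0#) → ∀ i → v i ≈ extend o (restrict o v) i
  extend-restrict (keep _ _)   v≈0 zero    = refl
  extend-restrict (keep _ o)   v≈0 (suc i) = extend-restrict o (v≈0 ∘ suc) i
  extend-restrict (skip d#e _) v≈0 zero    = v≈0 zero d#e
  extend-restrict (skip _ o)   v≈0 (suc i) = extend-restrict o (v≈0 ∘ suc) i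

  extend-cong : ∀ {e p k} {d : Vector R p} (o : Occurs e k d) {v w} →
    (∀ l → v l ≈ w l) → ∀ i → extend o v i ≈ extend o w i
  extend-cong (keep _ _) v≈w zero    = v≈w zero
  extend-cong (keep _ o) v≈w (suc i) = extend-cong o (v≈w ∘ suc) i
  extend-cong (skip _ _) v≈w zero    = refl
  extend-cong (skip _ o) v≈w (suc i) = extend-cong o v≈w i

  extend-zero⁻¹ : ∀ {e p k} {d : Vector R p} (o : Occurs e k d) {w} →
    (∀ i → extend o w i ≈ 0#) → ∀ l → w l ≈ 0#
  extend-zero⁻¹ (keep _ _) w≈0 zero    = w≈0 zero
  extend-zero⁻¹ (keep _ o) w≈0 (suc l) = extend-zero⁻¹ o (w≈0 ∘ suc) l
  extend-zero⁻¹ (skip _ o) w≈0 l       = extend-zero⁻¹ o (w≈0 ∘ suc) l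

  extend-combination : ∀ {e p k m} {d : Vector R p} (o : Occurs e k d) a (w : Vector (Vector R k) m) i →
    combination a (λ j → extend o (w j)) i ≈ extend o (combination a w) i
  extend-combination (keep _ _) a w zero    = refl
  extend-combination (keep _ o) a w (suc i) = extend-combination o a (λ j → w j ∘ suc) i
  extend-combination (skip _ _) a w zero    = ∑-zero (λ j → a j * 0#) (λ j → zeroʳ (a j))
  extend-combination (skip _ o) a w (suc i) = extend-combination o a w i

  unit : ∀ {m} → Fin m → Vector R m
  unit zero    zero    = 1#
  unit zero    (suc l) = 0#
  unit (suc k) zero    = 0#
  unit (suc k) (suc l) = unit k l

  ∑-unit : ∀ {m} (k : Fin m) → ∑ (unit k) ≈ 1#
  ∑-unit {suc m} zero    = trans (+-congˡ (sum-replicate-zero m)) (+-identityʳ 1#)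
  ∑-unit {suc m} (suc k) = trans (+-identityˡ _) (∑-unit k)

  combination-unit : ∀ {m} a (l : Fin m) → combination a unit l ≈ a l
  combination-unit {suc m} a zero = trans
    (+-cong (*-identityʳ _) (∑-zero (λ k → a (suc k) * 0#) (λ k → zeroʳ (a (suc k)))))
    (+-identityʳ _)
  combination-unit {suc m} a (suc l) = trans
    (+-cong (zeroʳ _) (combination-unit (a ∘ suc) l)) (+-identityˡ _)

  -- The standard basis of the hyperplane of sum 0, unit vectors minus the first one: the
  -- coordinates of `w` are its entries `w ∘ suc`.
  zeroSum : ∀ {m} → Vector (Vector R (suc m)) m
  zeroSum k zero    = - 1#
  zeroSum k (suc l) = unit k l

  ∑-zeroSum : ∀ {m} (k : Fin m) → ∑ (zeroSum k) ≈ 0#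
  ∑-zeroSum k = trans (+-congˡ (∑-unit k)) (-‿inverseˡ 1#)

  zeroSum-spanning : ∀ {m} (w : Vector R (suc m)) → ∑ w ≈ 0# →
    ∀ l → w l ≈ combination (w ∘ suc) zeroSum l
  zeroSum-spanning w ∑w≈0 zero = ≈-by
    (zero-+ (zero-* (- 1#) ∑w≈0) (≈⇒zero (*-distribʳ-sum (- 1#) (w ∘ suc))))
    (solve 3 (λ x s t → t :- x := (:- :1) :* (x :+ s) :+ (t :- s :* (:- :1))) refl
      (w zero) (∑ (w ∘ suc)) _)
  zeroSum-spanning w _ (suc l) = sym (combination-unit (w ∘ suc) l)

-- Laplacians of stars and their eigenvectors.

module StarMatrices {c ℓ₁ ℓ₂ : Level} (ℝ : RealNumbers c ℓ₁ ℓ₂) where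
  open RealProperties ℝ
  open Spectrum ℝ 
  open Occurrences ℝ

  ∑-single : ∀ {n} (f : Vector R n) i → (∀ j → j ≢ i → f j ≈ 0#) → ∑ f ≈ f i
  ∑-single {suc n} f zero    f≈0 =
    trans (+-congˡ (∑-zero (f ∘ suc) λ j → f≈0 (suc j) λ ())) (+-identityʳ _)
  ∑-single {suc n} f (suc i) f≈0 = trans
    (+-cong (f≈0 zero λ ()) (∑-single (f ∘ suc) i λ j j≢i → f≈0 (suc j) (j≢i ∘ suc-injective)))
    (+-identityˡ _)

  -- The common form of an arbitrary matrix of the star and of one built from weights, so that the
  -- eigenvectors are analysed once for both directions.
  record IsStarLaplacian {p} (A : Matrix (suc p)) (d : Vector R p) : Set ℓ₁ where
    field
      centre      : A zero zero ≈ ∑ d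
      centre-leaf : ∀ i → A zero (suc i) ≈ - d i
      leaf-centre : ∀ i → A (suc i) zero ≈ - d i
      leaf        : ∀ i → A (suc i) (suc i) ≈ d i
      leaves      : ∀ i j → j ≢ i → A (suc i) (suc j) ≈ 0#

  weights : ∀ {p} → Matrix (suc p) → Vector R p
  weights A i = - A zero (suc i)

  ∑-neg : ∀ {n} (f : Vector R n) → ∑ (λ i → - f i) ≈ - ∑ f
  ∑-neg f = trans
    (sum-cong-≋ λ i → solve 1 (λ x → :- x := (:- :1) :* x) refl (f i))
    (trans (sym (*-distribˡ-sum (- 1#) f)) (solve 1 (λ x → (:- :1) :* x := :- x) refl (∑ f)))

  module _ {p} {A : Matrix (suc p)} (A∈𝒮ᴸ : A ∈𝒮ᴸ star (suc p)) where
    open _∈𝒮ᴸ_ A∈𝒮ᴸ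

    weights-pos : ∀ i → 0# < weights A i
    weights-pos i = <-by (<⇒pos (edge zero (suc i) (inj₁ (≡.refl , λ ()))))
      (solve 1 (λ a → (:- a) :- :0 := :0 :- a) refl (A zero (suc i)))

    isStarLaplacian : IsStarLaplacian A (weights A)
    isStarLaplacian = record
      { centre      = trans (diagonal zero)
          (trans (-‿cong (+-identityˡ _)) (sym (∑-neg (λ i → A zero (suc i)))))
      ; centre-leaf = λ i → solve 1 (λ a → a := :- (:- a)) refl (A zero (suc i))
      ; leaf-centre = leaf-centre
      ; leaf        = λ i → trans (diagonal (suc i)) (-‿cong (trans
          (+-congˡ (∑-zero (λ k → if does (suc k ≟ suc i) then 0# else A (suc i) (suc k)) (off-diagonal i)))
          (trans (+-identityʳ _) (symmetric (suc i) zero))))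
      ; leaves      = leaves
      }
      where
      leaf-centre : ∀ i → A (suc i) zero ≈ - weights A i
      leaf-centre i = trans (symmetric (suc i) zero)
        (solve 1 (λ a → a := :- (:- a)) refl (A zero (suc i)))

      leaves : ∀ i j → j ≢ i → A (suc i) (suc j) ≈ 0#
      leaves i j j≢i = nonEdge (suc i) (suc j) (j≢i ∘ ≡.sym ∘ suc-injective)
        λ { (inj₁ (() , _)) ; (inj₂ (_ , ())) }

      off-diagonal : ∀ i k → (if does (suc k ≟ suc i) then 0# else A (suc i) (suc k)) ≈ 0#
      off-diagonal i k with k ≟ i
      ... | yes _   = refl
      ... | no  k≢i = leaves i k k≢i

  starLaplacian : ∀ {p} → Vector R p → Matrix (suc p)
  starLaplacian d zero    zero    = ∑ d
  starLaplacian d zero    (suc j) = - d j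
  starLaplacian d (suc i) zero    = - d i
  starLaplacian d (suc i) (suc j) = if does (j ≟ i) then d i else 0#

  starLaplacian-off-diagonal : ∀ {p} (d : Vector R p) i j → j ≢ i → starLaplacian d (suc i) (suc j) ≈ 0#
  starLaplacian-off-diagonal d i j j≢i with j ≟ i
  ... | yes j≡i = contradiction j≡i j≢i
  ... | no  _   = refl

  starLaplacian-isStarLaplacian : ∀ {p} (d : Vector R p) → IsStarLaplacian (starLaplacian d) d
  starLaplacian-isStarLaplacian d = record
    { centre      = refl
    ; centre-leaf = λ _ → refl
    ; leaf-centre = λ _ → refl
    ; leaf        = leaf
    ; leaves      = starLaplacian-off-diagonal d
    }
    where
    leaf : ∀ i → starLaplacian d (suc i) (suc i) ≈ d i
    leaf i with i ≟ i
    ... | yes _   = refl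
    ... | no  i≢i = contradiction ≡.refl i≢i

  starLaplacian∈𝒮ᴸ : ∀ {p} (d : Vector R p) → (∀ i → 0# < d i) → starLaplacian d ∈𝒮ᴸ star (suc p)
  starLaplacian∈𝒮ᴸ {p} d d-pos = record
    { symmetric = symmetric
    ; edge      = edge
    ; nonEdge   = nonEdge
    ; diagonal  = diagonal
    }
    where
    A = starLaplacian d
    open SimpleGraph (star (suc p)) using (Adj)

    -d<0 : ∀ i → - d i < 0#
    -d<0 i = <-by (d-pos i) (solve 1 (λ x → :0 :- (:- x) := x) refl (d i))

    symmetric : ∀ i j → A i j ≈ A j i
    symmetric zero    zero    = refl
    symmetric zero    (suc j) = refl
    symmetric (suc i) zero    = refl
    symmetric (suc i) (suc j) with i ≟ j
    ... | yes ≡.refl = IsStarLaplacian.leaf (starLaplacian-isStarLaplacian d) i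
    ... | no  i≢j    = starLaplacian-off-diagonal d i j (i≢j ∘ ≡.sym)

    edge : ∀ i j → Adj i j → A i j < 0#
    edge zero    zero    (inj₁ (_ , ¬c)) = contradiction ≡.refl ¬c
    edge zero    zero    (inj₂ (¬c , _)) = contradiction ≡.refl ¬c
    edge zero    (suc j) _               = -d<0 j
    edge (suc i) zero    _               = -d<0 i
    edge (suc i) (suc j) (inj₁ (() , _))
    edge (suc i) (suc j) (inj₂ (_ , ()))

    nonEdge : ∀ i j → i ≢ j → ¬ Adj i j → A i j ≈ 0#
    nonEdge zero    zero    i≢j _    = contradiction ≡.refl i≢j
    nonEdge zero    (suc j) _   ¬adj = contradiction (inj₁ (≡.refl , λ ())) ¬adj
    nonEdge (suc i) zero    _   ¬adj = contradiction (inj₂ ((λ ()) , ≡.refl)) ¬adj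
    nonEdge (suc i) (suc j) i≢j _    = starLaplacian-off-diagonal d i j (i≢j ∘ ≡.cong suc ∘ ≡.sym)

    diagonal : ∀ i → A i i ≈ - ∑ (λ k → if does (k ≟ i) then 0# else A i k)
    diagonal zero = trans
      (solve 1 (λ s → s := :- (:0 :+ (:- s))) refl (∑ d))
      (-‿cong (+-congˡ (sym (∑-neg d))))
    diagonal (suc i) = trans (IsStarLaplacian.leaf (starLaplacian-isStarLaplacian d) i) (trans
      (solve 1 (λ x → x := :- ((:- x) :+ :0)) refl (d i))
      (-‿cong (+-congˡ (sym (∑-zero
        (λ k → if does (suc k ≟ suc i) then 0# else A (suc i) (suc k)) off-diagonal)))))
      where
      off-diagonal : ∀ k → (if does (suc k ≟ suc i) then 0# else A (suc i) (suc k)) ≈ 0#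
      off-diagonal k with k ≟ i
      ... | yes _ = refl
      ... | no  _ = refl

  module StarEigen {p} {A : Matrix (suc p)} {d : Vector R p}
                   (laplacian : IsStarLaplacian A d) (d-pos : ∀ i → 0# < d i) where
    open IsStarLaplacian laplacian
    open SecularEquation ℝ d d-pos

    leaf-row : ∀ (v : Vector R (suc p)) i → ∑ (λ j → A (suc i) j * v j) ≈ d i * (v (suc i) - v zero)
    leaf-row v i = trans
      (+-cong (*-congʳ (leaf-centre i)) (trans
        (∑-single (λ j → A (suc i) (suc j) * v (suc j)) i λ j j≢i →
          trans (*-congʳ (leaves i j j≢i)) (zeroˡ _))
        (*-congʳ (leaf i))))
      (solve 3 (λ d x y → (:- d) :* x :+ d :* y := d :* (y :- x)) refl (d i) (v zero) (v (suc i)))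

    centre-row : ∀ (v : Vector R (suc p)) → ∑ (λ j → A zero j * v j) ≈ - ∑ (λ i → d i * (v (suc i) - v zero))
    centre-row v = trans
      (+-cong (trans (*-congʳ centre) (*-distribʳ-sum (v zero) d))
        (sum-cong-≋ λ i → *-congʳ (centre-leaf i)))
      (trans (sym (∑-distrib-+ (λ i → d i * v zero) (λ i → - d i * v (suc i))))
        (trans
          (sum-cong-≋ λ i → solve 3 (λ d x y → d :* x :+ (:- d) :* y := :- (d :* (y :- x))) refl
            (d i) (v zero) (v (suc i)))
          (∑-neg (λ i → d i * (v (suc i) - v zero)))))

    -- The columns of a Laplacian sum to 0, so the row of the centre may be traded for the sum of
    -- all rows, which is `sum-zero`.
    record Eigen (μ : R) (v : Vector R (suc p)) : Set ℓ₁ where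
      field
        at-leaf  : ∀ i → d i * (v (suc i) - v zero) ≈ μ * v (suc i)
        sum-zero : μ * ∑ v ≈ 0#

    toEigen : ∀ {μ v} → InEigenspace A μ v → Eigen μ v
    toEigen {μ} {v} Av≈μv = record
      { at-leaf  = at-leaf
      ; sum-zero = trans (distribˡ μ _ _) (trans
          (+-cong (trans (sym (Av≈μv zero)) (centre-row v))
            (trans (*-distribˡ-sum μ (v ∘ suc)) (sum-cong-≋ (λ i → sym (at-leaf i)))))
          (-‿inverseˡ _))
      }
      where
      at-leaf : ∀ i → d i * (v (suc i) - v zero) ≈ μ * v (suc i)
      at-leaf i = trans (sym (leaf-row v i)) (Av≈μv (suc i))

    fromEigen : ∀ {μ v} → Eigen μ v → InEigenspace A μ v
    fromEigen {μ} {v} ev (suc i) = trans (leaf-row v i) (Eigen.at-leaf ev i)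
    fromEigen {μ} {v} ev zero = trans (centre-row v) (trans
      (-‿cong (trans (sum-cong-≋ (Eigen.at-leaf ev)) (sym (*-distribˡ-sum μ (v ∘ suc)))))
      (≈-by (Eigen.sum-zero ev)
        (solve 3 (λ m x s → m :* x :- (:- (m :* s)) := m :* (x :+ s)) refl μ (v zero) (∑ (v ∘ suc)))))

    line-multiplicity : ∀ {μ} u → Eigen μ u → u zero ≈ 1# →
      (∀ v → Eigen μ v → ∀ i → v (suc i) ≈ v zero * u (suc i)) → HasMultiplicity A μ 1
    line-multiplicity {μ} u uE u₀≈1 spans = (λ _ → u) , record
      { inEigenspace = λ _ → fromEigen uE
      ; independent  = λ { a a*u≈0 zero → trans
          (sym (trans (+-identityʳ _) (trans (*-congˡ u₀≈1) (*-identityʳ _)))) (a*u≈0 zero) }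
      ; spanning     = λ v vE → (λ _ → v zero) , λ
          { zero    → sym (trans (+-identityʳ _) (trans (*-congˡ u₀≈1) (*-identityʳ _)))
          ; (suc i) → trans (spans v (toEigen vE) i) (sym (+-identityʳ _))
          }
      }

    line-eigenvalue : ∀ {μ} u → Eigen μ u → u zero ≈ 1# → IsEigenvalue A μ
    line-eigenvalue u uE u₀≈1 = u , (zero , #-congʳ (sym u₀≈1) 1#0) , fromEigen uE

    ones : Vector R (suc p)
    ones _ = 1#

    ones-eigen : Eigen 0# ones
    ones-eigen = record
      { at-leaf  = λ i → solve 1 (λ d → d :* (:1 :- :1) := :0 :* :1) refl (d i)
      ; sum-zero = zeroˡ _
      }

    zero-eigenvalue : IsEigenvalue A 0#
    zero-eigenvalue = line-eigenvalue ones ones-eigen refl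

    zero-multiplicity : HasMultiplicity A 0# 1
    zero-multiplicity = line-multiplicity ones ones-eigen refl λ v vE i →
      trans (≈-by (#0-cancelˡ (>⇒# (d-pos i)) (trans
          (solve 3 (λ d x y → d :* (x :- y) := (:- :1) :* (d :* (y :- x))) refl (d i) (v zero) (v (suc i)))
          (zero-* (- 1#) (trans (Eigen.at-leaf vE i) (zeroˡ _))))) refl)
        (sym (*-identityʳ _))

    leaf-value : ∀ {μ w v} → Inverses μ w → Eigen μ v → ∀ i → v (suc i) ≈ v zero * - (d i * w i)
    leaf-value {μ} {w} {v} wμ vE i = ≈-by
      (zero-+ (zero-* (v (suc i)) (≈⇒zero (sym (wμ i)))) (zero-* (w i) (≈⇒zero (sym (Eigen.at-leaf vE i)))))
      (solve 5 (λ μ d w x y → x :* (:- (d :* w)) :- y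
          := y :* (w :* (μ :- d) :- :1) :+ w :* (d :* (y :- x) :- μ :* y)) refl
        μ (d i) (w i) (v zero) (v (suc i)))

    rootVector : Vector R p → Vector R (suc p)
    rootVector w zero    = 1#
    rootVector w (suc i) = - (d i * w i)

    ∑-rootVector : ∀ w → ∑ (rootVector w) ≈ 1# - secular w
    ∑-rootVector w = +-congˡ (∑-neg (λ i → d i * w i))

    rootVector-eigen : ∀ {ρ w} → Inverses ρ w → secular w ≈ 1# → Eigen ρ (rootVector w)
    rootVector-eigen {ρ} {w} wρ Sw≈1 = record
      { at-leaf  = λ i → ≈-by (zero-* (- d i) (≈⇒zero (sym (wρ i))))
          (solve 3 (λ ρ d w → ρ :* (:- (d :* w)) :- d :* ((:- (d :* w)) :- :1)
            := (:- d) :* (w :* (ρ :- d) :- :1)) refl ρ (d i) (w i))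
      ; sum-zero = zero-* ρ (trans (∑-rootVector w) (≈⇒zero Sw≈1))
      }

    root-eigenvalue : ∀ {ρ} → IsRoot ρ → IsEigenvalue A ρ
    root-eigenvalue (w , wρ , Sw≈1) =
      line-eigenvalue (rootVector w) (rootVector-eigen wρ Sw≈1) refl

    root-multiplicity : ∀ {ρ} → IsRoot ρ → HasMultiplicity A ρ 1
    root-multiplicity (w , wρ , Sw≈1) =
      line-multiplicity (rootVector w) (rootVector-eigen wρ Sw≈1) refl λ v vE → leaf-value wρ vE

    #0-factorʳ : ∀ {x y} → x * y # 0# → y # 0#
    #0-factorʳ {x} {y} xy#0 = let v , v*xy≈1 = inverse₀ xy#0 in
      inverse-# (trans (solve 3 (λ x y v → y :* (v :* x) := v :* (x :* y)) refl x y v) v*xy≈1)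

    -- All entries of the eigenvector are multiples of `v zero`, which is therefore apart from 0.
    -- The sum of the entries is `v zero * (1# - secular w)`; cancelling `μ` and then `v zero`
    -- leaves the equation.
    eigenvalue-off-poles : ∀ {μ w} → IsEigenvalue A μ → μ # 0# → Inverses μ w → secular w ≈ 1#
    eigenvalue-off-poles {μ} {w} (v , (j , vj#0) , Av≈μv) μ#0 wμ =
      ≈-by 1-Sw≈0 refl
      where
      vE = toEigen Av≈μv

      v₀#0 : v zero # 0#
      v₀#0 = centre-nonzero j vj#0
        where
        centre-nonzero : ∀ j → v j # 0# → v zero # 0#
        centre-nonzero zero    v₀#0 = v₀#0
        centre-nonzero (suc i) vi#0 = #0-factorʳ
          (#-congʳ (trans (leaf-value wμ vE i) (*-comm _ _)) vi#0)

      1-Sw≈0 : 1# - secular w ≈ 0#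
      1-Sw≈0 = #0-cancelˡ v₀#0 (trans
        (sym (trans (+-congˡ (sum-cong-≋ (leaf-value wμ vE)))
          (trans (+-congʳ (sym (*-identityʳ _)))
            (trans (sym (*-distribˡ-sum (v zero) (rootVector w))) (*-congˡ (∑-rootVector w))))))
        (#0-cancelˡ μ#0 (Eigen.sum-zero vE)))

    module _ {e k} (o : Occurs e (suc k) d) (e-pos : 0# < e) where

      private
        e#0 = >⇒# e-pos

      poleVector : Vector (Vector R (suc p)) k
      poleVector j zero    = 0#
      poleVector j (suc i) = extend o (zeroSum j) i

      poleVector-eigen : ∀ j → Eigen e (poleVector j)
      poleVector-eigen j = record
        { at-leaf  = λ i → trans
            (solve 2 (λ d x → d :* (x :- :0) := d :* x) refl (d i) (extend o (zeroSum j) i))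
            (extend-supported o (zeroSum j) i)
        ; sum-zero = zero-* e (zero-+ refl (trans (∑-extend o (zeroSum j)) (∑-zeroSum j)))
        }

      -- At a leaf of weight `e` the terms with the value of that leaf cancel, and `e * v zero ≈ 0#`
      -- is left.
      pole-centre : ∀ {v} → Eigen e v → v zero ≈ 0#
      pole-centre {v} vE = let i , di≈e = occurs-at o in #0-cancelˡ e#0 (trans
        (≈-by (zero-+ (zero-* (v (suc i)) (≈⇒zero di≈e)) (zero-+ (zero-* (v zero) (≈⇒zero (sym di≈e)))
          (≈⇒zero (sym (Eigen.at-leaf vE i)))))
          (solve 4 (λ e d x y → :0 :- e :* x
              := y :* (e :- d) :+ (x :* (d :- e) :+ (d :* (y :- x) :- e :* y))) refl
            e (d i) (v zero) (v (suc i))))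
        refl)

      pole-supported : ∀ {v} → Eigen e v → ∀ i → d i # e → v (suc i) ≈ 0#
      pole-supported {v} vE i di#e = let z , z*[d-e]≈1 = inverse di#e in #0-cancelˡ
        (inverse-# (trans (*-comm _ _) z*[d-e]≈1))
        (trans
          (solve 4 (λ e d x y → (d :- e) :* y := (d :* (y :- x) :- e :* y) :+ d :* x) refl
            e (d i) (v zero) (v (suc i)))
          (zero-+ (≈⇒zero (sym (Eigen.at-leaf vE i))) (zero-* (d i) (pole-centre vE))))

      leafValues : Vector R (suc p) → Vector R (suc k)
      leafValues v = restrict o (v ∘ suc)

      pole-extend : ∀ {v} → Eigen e v → ∀ i → v (suc i) ≈ extend o (leafValues v) i
      pole-extend vE = extend-restrict o (pole-supported vE)

      ∑-leafValues : ∀ {v} → Eigen e v → ∑ (leafValues v) ≈ 0#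
      ∑-leafValues {v} vE = trans (sym (trans (sum-cong-≋ (pole-extend vE)) (∑-extend o _)))
        (trans (trans (sym (+-identityˡ _)) (+-congʳ (sym (pole-centre vE))))
          (#0-cancelˡ e#0 (Eigen.sum-zero vE)))

      combination-poleVector : ∀ a i →
        combination a poleVector (suc i) ≈ extend o (combination a zeroSum) i
      combination-poleVector a i = extend-combination o a zeroSum i

      pole-multiplicity : HasMultiplicity A e k
      pole-multiplicity = poleVector , record
        { inEigenspace = λ j → fromEigen (poleVector-eigen j)
        ; independent  = λ a a*u≈0 j → trans (sym (combination-unit a j))
            (extend-zero⁻¹ o (λ i → trans (sym (combination-poleVector a i)) (a*u≈0 (suc i))) (suc j))
        ; spanning     = λ v vE → leafValues v ∘ suc , spans (toEigen vE)
        }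
        where
        spans : ∀ {v} → Eigen e v → ∀ i → v i ≈ combination (leafValues v ∘ suc) poleVector i
        spans {v} vE zero    = trans (pole-centre vE)
          (sym (∑-zero (λ j → leafValues v (suc j) * 0#) (λ j → zeroʳ _)))
        spans {v} vE (suc i) = trans (pole-extend vE i) (trans
          (extend-cong o (zeroSum-spanning (leafValues v) (∑-leafValues vE)) i)
          (sym (combination-poleVector (leafValues v ∘ suc) i)))

    pole-eigenvalue : ∀ {e k} → Occurs e (suc (suc k)) d → 0# < e → IsEigenvalue A e
    pole-eigenvalue {e} {k} o e-pos = let i , nonzero = entry o in
      poleVector o e-pos zero , (suc i , nonzero) , fromEigen (poleVector-eigen o e-pos zero)
      where
      entry : ∀ {q} {f : Vector R q} (o : Occurs e (suc (suc k)) f) → ∃[ i ] extend o (zeroSum zero) i # 0#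
      entry (keep _ o) = zero , inverse-# {x = - 1#} (solve 0 ((:- :1) :* (:- :1) := :1) refl)
      entry (skip _ o) = let i , nonzero = entry o in suc i , nonzero

    -- A vector supported on one leaf and of sum 0 vanishes.
    simple-pole : ∀ {e} → Occurs e 1 d → 0# < e → ¬ IsEigenvalue A e
    simple-pole {e} o e-pos (v , (j , vj#0) , Av≈ev) = proj₂ (tight (v j) 0#) (v≈0 j) vj#0
      where
      vE = toEigen Av≈ev

      leafValue≈0 : ∀ l → leafValues o e-pos v l ≈ 0#
      leafValue≈0 zero = trans (sym (+-identityʳ _)) (∑-leafValues o e-pos vE)

      v≈0 : ∀ j → v j ≈ 0#
      v≈0 zero    = pole-centre o e-pos vE
      v≈0 (suc i) = trans (pole-extend o e-pos vE i)
        (trans (extend-cong o leafValue≈0 i) (extend-zero o i))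
        where
        extend-zero : ∀ {e p k} {d : Vector R p} (o : Occurs e k d) i → extend o (λ _ → 0#) i ≈ 0#
        extend-zero (keep _ _) zero    = refl
        extend-zero (keep _ o) (suc i) = extend-zero o i
        extend-zero (skip _ _) zero    = refl
        extend-zero (skip _ o) (suc i) = extend-zero o i

-- Admissible lists and group sizes.

-- The entry k stands for a group of k + 1 leaves of equal weight e.  It
-- contributes the eigenvalue e with multiplicity k, unless k is 0, and a
-- simple eigenvalue between e and the next weight.
expand : List ℕ → List ℕ
expand []           = []
expand (zero  ∷ ks) = 1 ∷ expand ks
expand (suc k ∷ ks) = suc k ∷ 1 ∷ expand ks

sum-expand : ∀ ks → sum (expand ks) ≡ sum (map suc ks)
sum-expand []           = ≡.refl
sum-expand (zero  ∷ ks) = ≡.cong suc (sum-expand ks)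
sum-expand (suc k ∷ ks) = ≡.trans
  (≡.cong (λ s → suc k ℕ.+ suc s) (sum-expand ks)) (ℕ.+-suc (suc k) _)

expand-admissible : ∀ ks → Admissible (suc (sum (map suc ks))) (1 ∷ expand ks)
expand-admissible ks = record
  { positive = s≤s z≤n ∷ positive ks
  ; first    = ≡.refl
  ; final    = final ks
  ; isolated = isolated ks
  ; total    = ≡.cong suc (sum-expand ks)
  }
  where
  positive : ∀ ks → All (0 ℕ.<_) (expand ks)
  positive []           = []
  positive (zero  ∷ ks) = s≤s z≤n ∷ positive ks
  positive (suc k ∷ ks) = s≤s z≤n ∷ s≤s z≤n ∷ positive ks

  final : ∀ ks → last (1 ∷ expand ks) ≡ just 1
  final []           = ≡.refl
  final (zero  ∷ ks) = final ks
  final (suc k ∷ ks) = final ks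

  isolated : ∀ ks → Linked (λ m m′ → 2 ℕ.≤ m → m′ ≡ 1) (1 ∷ expand ks)
  isolated []           = [-]
  isolated (zero  ∷ ks) = (λ { (s≤s ()) }) ∷ isolated ks
  isolated (suc k ∷ ks) = (λ { (s≤s ()) }) ∷ (λ _ → ≡.refl) ∷ isolated ks

-- The 1 in front stands for the entry already consumed and keeps the hypotheses in the same form
-- for the tail. An entry of at least 2 is not the last one, hence has a 1 after it, and both are
-- read as one group. As `expand` is not injective, a choice is made: each remaining 1 is read as a
-- group of one leaf.
collapse : ∀ ms → All (0 ℕ.<_) ms → last (1 ∷ ms) ≡ just 1 →
  Linked (λ m m′ → 2 ℕ.≤ m → m′ ≡ 1) (1 ∷ ms) → ∃[ ks ] expand ks ≡ ms
collapse []            _        _     _              = [] , ≡.refl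
collapse (1 ∷ ms)      (_ ∷ ps) last1 (_ ∷ ls)       =
  let ks , eq = collapse ms ps last1 ls in zero ∷ ks , ≡.cong (1 ∷_) eq
collapse (suc (suc m) ∷ m′ ∷ ms) (_ ∷ _ ∷ ps) last1 (_ ∷ l ∷ ls) with l (s≤s (s≤s z≤n))
... | ≡.refl = let ks , eq = collapse ms ps last1 ls in
  suc (suc m) ∷ ks , ≡.cong (λ ms → suc (suc m) ∷ 1 ∷ ms) eq

admissible⇒expand : ∀ {p ms} → Admissible (suc p) ms →
  ∃[ ks ] ms ≡ 1 ∷ expand ks × sum (map suc ks) ≡ p
admissible⇒expand {p} {m ∷ ms} adm with Admissible.first adm
... | ≡.refl =
  let ks , expand≡ms = collapse ms (All.tail positive) final isolated
  in ks , ≡.cong (1 ∷_) (≡.sym expand≡ms) ,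
     ≡.trans (≡.sym (sum-expand ks)) (≡.trans (≡.cong sum expand≡ms) (ℕ.suc-injective total))
  where open Admissible adm

admissible-stable : ∀ n ms → Stable (Admissible n ms)
admissible-stable n ms ¬¬adm = record
  { positive = decidable-stable (All.all? (0 ℕ.<?_) ms) (¬¬-map Admissible.positive ¬¬adm)
  ; first    = decidable-stable (Maybe.≡-dec ℕ._≟_ _ _) (¬¬-map Admissible.first ¬¬adm)
  ; final    = decidable-stable (Maybe.≡-dec ℕ._≟_ _ _) (¬¬-map Admissible.final ¬¬adm)
  ; isolated = decidable-stable (linked? (λ m m′ → (2 ℕ.≤? m) →-dec (m′ ℕ.≟ 1)) ms)
                 (¬¬-map Admissible.isolated ¬¬adm)
  ; total    = decidable-stable (sum ms ℕ.≟ n) (¬¬-map Admissible.total ¬¬adm)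
  }

-- Uniqueness of the multiplicity list.

module Multiplicities {c ℓ₁ ℓ₂ : Level} (ℝ : RealNumbers c ℓ₁ ℓ₂) where
  open RealProperties ℝ
  open Spectrum ℝ

  -- A pivot cannot be searched for, but elimination below refutes independence and so may assume
  -- that the search has been settled.
  ¬¬-nonzero-or-zero : ∀ {n} (f : Vector R n) → ¬ ¬ ((∃[ i ] f i # 0#) ⊎ (∀ i → f i ≈ 0#))
  ¬¬-nonzero-or-zero f k =
    k (inj₂ λ i → proj₁ (tight (f i) 0#) λ fi#0 → k (inj₁ (i , fi#0)))

  -- Gaussian elimination on the first column of C.
  dependent : ∀ {m n} → m ℕ.< n → (C : Fin n → Fin m → R) →
    ¬ (∀ (a : Vector R n) → (∀ l → ∑ (λ k → a k * C k l) ≈ 0#) → ∀ k → a k ≈ 0#)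
  dependent {zero} {suc n} _ C independent =
    proj₂ (tight 1# 0#) (independent (λ _ → 1#) (λ ()) zero) 1#0
  dependent {suc m} {suc n} (s≤s m<n) C independent =
    ¬¬-nonzero-or-zero (λ k → C k zero) λ where
      (inj₂ column≈0) → dependent (ℕ.m<n⇒m<1+n m<n) (λ k l → C k (suc l)) λ a a*C≈0 →
        independent a λ where
          zero    → ∑-zero (λ k → a k * C k zero) (λ k → zero-* (a k) (column≈0 k))
          (suc l) → a*C≈0 l
      (inj₁ (k , pivot#0)) → let v , v*pivot≈1 = inverse₀ pivot#0 in
        dependent m<n (λ j l → C (punchIn k j) (suc l) - C (punchIn k j) zero * (v * C k (suc l)))
          λ a a*C′≈0 j →
            let s = ∑ λ j → a j * C (punchIn k j) zero
                -- The coefficient of the pivot row is chosen to cancel the first column; in the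
                -- other columns the combination then agrees with that of the reduced rows.
                b = insertAt a k (- (s * v))

                b*C : ∀ l → ∑ (λ i → b i * C i l) ≈ - (s * v) * C k l + ∑ (λ j → a j * C (punchIn k j) l)
                b*C l = trans (sum-remove {i = k} (λ i → b i * C i l)) (+-cong
                  (*-congʳ (reflexive (insertAt-lookup a k _)))
                  (sum-cong-≋ λ j → *-congʳ (reflexive (insertAt-punchIn a k _ j))))

                a*C′ : ∀ l → ∑ (λ j → a j * (C (punchIn k j) (suc l) - C (punchIn k j) zero * (v * C k (suc l))))
                  ≈ ∑ (λ j → a j * C (punchIn k j) (suc l)) - s * (v * C k (suc l))
                a*C′ l = trans
                  (sum-cong-≋ λ j → solve 4 (λ a x y z → a :* (x :- y :* z) := a :* x :- a :* y :* z) refl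
                    (a j) (C (punchIn k j) (suc l)) (C (punchIn k j) zero) (v * C k (suc l)))
                  (trans (∑-distrib-- (λ j → a j * C (punchIn k j) (suc l))
                      (λ j → a j * C (punchIn k j) zero * (v * C k (suc l))))
                    (+-congˡ (-‿cong (sym (*-distribʳ-sum (v * C k (suc l)) (λ j → a j * C (punchIn k j) zero))))))

                b*C≈0 : ∀ l → ∑ (λ i → b i * C i l) ≈ 0#
                b*C≈0 = λ where
                  zero    → trans (b*C zero) (trans
                    (solve 3 (λ s v x → (:- (s :* v)) :* x :+ s := s :* (:1 :- v :* x)) refl s v (C k zero))
                    (zero-* s (≈⇒zero v*pivot≈1)))
                  (suc l) → trans (b*C (suc l)) (trans
                    (solve 4 (λ s v x t → (:- (s :* v)) :* x :+ t := t :- s :* (v :* x)) refl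
                      s v (C k (suc l)) (∑ λ j → a j * C (punchIn k j) (suc l)))
                    (trans (sym (a*C′ l)) (a*C′≈0 l)))
            in trans (sym (reflexive (insertAt-punchIn a k _ j))) (independent b b*C≈0 (punchIn k j))

  eigenspace-resp : ∀ {n} {A : Matrix n} {μ ν v} → μ ≈ ν → InEigenspace A μ v → InEigenspace A ν v
  eigenspace-resp μ≈ν Av≈μv i = trans (Av≈μv i) (*-congʳ μ≈ν)

  -- If `w` were longer than `u`, its coordinates in terms of `u` would form more rows than columns,
  -- and a relation among the rows is one among the vectors of `w`.
  dimension-≤ : ∀ {n} {A : Matrix n} {μ ν k m} → μ ≈ ν →
    HasMultiplicity A μ k → HasMultiplicity A ν m → m ℕ.≤ k
  dimension-≤ {n} {A} {k = k} {m} μ≈ν (u , uBasis) (w , wBasis) = ℕ.≮⇒≥ λ k<m →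
    dependent k<m C λ a a*C≈0 → W.independent a λ i → begin
      ∑ (λ j → a j * w j i)                            ≈⟨ sum-cong-≋ (λ j → *-congˡ (w≈Cu j i)) ⟩
      ∑ (λ j → a j * ∑ (λ l → C j l * u l i))          ≈⟨ sum-cong-≋ (λ j → *-distribˡ-sum (a j) (λ l → C j l * u l i)) ⟩
      ∑ (λ j → ∑ (λ l → a j * (C j l * u l i)))        ≈⟨ ∑-comm (λ j l → a j * (C j l * u l i)) ⟩
      ∑ (λ l → ∑ (λ j → a j * (C j l * u l i)))        ≈⟨ sum-cong-≋ (λ l → sum-cong-≋ λ j → sym (*-assoc (a j) (C j l) (u l i))) ⟩
      ∑ (λ l → ∑ (λ j → a j * C j l * u l i))          ≈⟨ sum-cong-≋ (λ l → sym (*-distribʳ-sum (u l i) (λ j → a j * C j l))) ⟩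
      ∑ (λ l → ∑ (λ j → a j * C j l) * u l i)          ≈⟨ ∑-zero _ (λ l → trans (*-congʳ (a*C≈0 l)) (zeroˡ _)) ⟩
      0#                                               ∎
    where
    open import Relation.Binary.Reasoning.Setoid setoid
    module U = IsEigenbasis uBasis
    module W = IsEigenbasis wBasis

    expansion : ∀ j → ∃[ a ] (∀ i → w j i ≈ combination a u i)
    expansion j = U.spanning (w j) (eigenspace-resp {A = A} (sym μ≈ν) (W.inEigenspace j))

    C : Fin m → Fin k → R
    C j = proj₁ (expansion j)

    w≈Cu : ∀ j i → w j i ≈ combination (C j) u i
    w≈Cu j = proj₂ (expansion j)

  multiplicity-unique : ∀ {n} {A : Matrix n} {μ ν k m} → μ ≈ ν →
    HasMultiplicity A μ k → HasMultiplicity A ν m → k ≡ m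
  multiplicity-unique {A = A} μ≈ν hk hm =
    ℕ.≤-antisym (dimension-≤ {A = A} (sym μ≈ν) hm hk) (dimension-≤ {A = A} μ≈ν hk hm)

  Increasing : ∀ {n} → Vector R n → Set ℓ₂
  Increasing f = ∀ i j → i Fin.< j → f i < f j

  -- The first values agree, being the least of the same set. Every later value is strictly larger,
  -- so its partner is never the first one, and the argument repeats on the tails.
  same-values⇒same-list : ∀ (ms ms′ : List ℕ) (f : Vector R (length ms)) (g : Vector R (length ms′)) →
    Increasing f → Increasing g →
    (∀ i → ∃[ j ] f i ≈ g j) → (∀ j → ∃[ i ] g j ≈ f i) →
    (∀ i j → f i ≈ g j → lookup ms i ≡ lookup ms′ j) → ms ≡ ms′
  same-values⇒same-list []       []         f g _ _ _   _   _ = ≡.refl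
  same-values⇒same-list []       (m′ ∷ ms′) f g _ _ _   g⊆f _ = contradiction (proj₁ (g⊆f zero)) λ ()
  same-values⇒same-list (m ∷ ms) []         f g _ _ f⊆g _   _ = contradiction (proj₁ (f⊆g zero)) λ ()
  same-values⇒same-list (m ∷ ms) (m′ ∷ ms′) f g f↑ g↑ f⊆g g⊆f same =
    ≡.cong₂ _∷_ (same zero zero f₀≈g₀)
      (same-values⇒same-list ms ms′ (f ∘ suc) (g ∘ suc)
        (λ i j i<j → f↑ (suc i) (suc j) (s≤s i<j)) (λ i j i<j → g↑ (suc i) (suc j) (s≤s i<j))
        (λ i → tail-value (f↑ zero (suc i) (s≤s z≤n)) f₀≈g₀ (f⊆g (suc i)))
        (λ j → tail-value (g↑ zero (suc j) (s≤s z≤n)) (sym f₀≈g₀) (g⊆f (suc j)))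
        (λ i j → same (suc i) (suc j)))
    where
    first-least : ∀ {n} {h : Vector R (suc n)} → Increasing h → ∀ i → h zero ≤ h i
    first-least h↑ zero    = <-irrefl refl
    first-least h↑ (suc i) = <-asym (h↑ zero (suc i) (s≤s z≤n))

    f₀≈g₀ : f zero ≈ g zero
    f₀≈g₀ = ≤-antisym
      (λ g₀<f₀ → let i , g₀≈fi = g⊆f zero in first-least f↑ i (<-respˡ-≈ g₀≈fi g₀<f₀))
      (λ f₀<g₀ → let j , f₀≈gj = f⊆g zero in first-least g↑ j (<-respˡ-≈ f₀≈gj f₀<g₀))

    tail-value : ∀ {x y n} {h : Vector R (suc n)} → x < y → x ≈ h zero →
      ∃[ j ] y ≈ h j → ∃[ j ] y ≈ h (suc j)
    tail-value x<y x≈h₀ (zero  , y≈h₀) = contradiction x<y (<-irrefl (trans x≈h₀ (sym y≈h₀)))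
    tail-value x<y x≈h₀ (suc j , y≈hj) = j , y≈hj

  multiplicity-list-unique : ∀ {n} {A : Matrix n} {ms ms′} →
    IsOrderedMultiplicityList A ms → IsOrderedMultiplicityList A ms′ → ms ≡ ms′
  multiplicity-list-unique {A = A} L L′ = same-values⇒same-list _ _ L.eigenvalue L′.eigenvalue
    L.increasing L′.increasing
    (λ i → Equivalence.to (L′.spectrum (L.eigenvalue i)) (Equivalence.from (L.spectrum _) (i , refl)))
    (λ j → Equivalence.to (L.spectrum (L′.eigenvalue j)) (Equivalence.from (L′.spectrum _) (j , refl)))
    (λ i j λi≈λj → multiplicity-unique {A = A} λi≈λj (L.multiplicity i) (L′.multiplicity j))
    where
    module L  = IsOrderedMultiplicityList L
    module L′ = IsOrderedMultiplicityList L′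

-- Grouping equal weights.

module Groupings {c ℓ₁ ℓ₂ : Level} (ℝ : RealNumbers c ℓ₁ ℓ₂) where
  open RealProperties ℝ
  open Occurrences ℝ

  _<₁_ : R × ℕ → R × ℕ → Set ℓ₂
  (x , _) <₁ (y , _) = x < y

  infix 4 _∈ᵉ_ _#ᵉ_ _<ᵉ_ _≤ᵉ_

  _∈ᵉ_ : R → List (R × ℕ) → Set (c ⊔ ℓ₁)
  x ∈ᵉ es = Any (λ (e , _) → x ≈ e) es

  _#ᵉ_ _<ᵉ_ _≤ᵉ_ : R → List (R × ℕ) → Set (c ⊔ ℓ₂)
  x #ᵉ es = All (λ (e , _) → x # e) es
  x <ᵉ es = All (λ (e , _) → x < e) es
  x ≤ᵉ es = All (λ (e , _) → x ≤ e) es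

  -- The entry (e , k) of the list says that e occurs k + 1 times in d.
  record Grouping {p} (d : Vector R p) (es : List (R × ℕ)) : Set (c ⊔ ℓ₁ ⊔ ℓ₂) where
    field
      sorted  : AllPairs _<₁_ es
      occurs  : All (λ (e , k) → Occurs e (suc k) d) es
      covered : ∀ i → d i ∈ᵉ es
      size    : sum (map (suc ∘ proj₂) es) ≡ p

  grouping-[] : {d : Vector R 0} → Grouping d []
  grouping-[] = record { sorted = [] ; occurs = [] ; covered = λ () ; size = ≡.refl }

  occurs-zero : ∀ {e p} {d : Vector R p} → (∀ i → d i # e) → Occurs e 0 d
  occurs-zero {p = zero}  _   = done
  occurs-zero {p = suc p} d#e = skip (d#e zero) (occurs-zero (d#e ∘ suc))

  -- The new list is given up to permutation because only sortedness depends on the place where the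
  -- weight is inserted.
  new-group : ∀ {p} {d : Vector R (suc p)} {es es′} → Grouping (d ∘ suc) es →
    d zero #ᵉ es → es′ ↭ (d zero , 0) ∷ es → AllPairs _<₁_ es′ → Grouping d es′
  new-group {p} {d} {es} g d₀#es es′↭ sorted′ = record
    { sorted  = sorted′
    ; occurs  = All-resp-↭ (↭-sym es′↭)
        (keep refl (occurs-zero (λ i → let d₀#e , di≈e = All.lookupAny d₀#es (covered i) in
            #-sym (#-congˡ (sym di≈e) d₀#e)))
          ∷ All.zipWith (λ (d₀#e , o) → skip d₀#e o) (d₀#es , occurs))
    ; covered = λ { zero → Any-resp-↭ (↭-sym es′↭) (here refl)
                  ; (suc i) → Any-resp-↭ (↭-sym es′↭) (there (covered i)) }
    ; size    = ≡.trans (sum-↭ (map⁺ (suc ∘ proj₂) es′↭)) (≡.cong suc size)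
    }
    where open Grouping g

  increment : ∀ {x} es → x ∈ᵉ es → List (R × ℕ)
  increment ((e , k) ∷ es) (here _)    = (e , suc k) ∷ es
  increment (ek ∷ es)      (there x∈) = ek ∷ increment es x∈

  increment-All : ∀ {q} {P : R → Set q} {x} {es} (x∈ : x ∈ᵉ es) →
    All (P ∘ proj₁) es → All (P ∘ proj₁) (increment es x∈)
  increment-All (here _)   (pe ∷ pes) = pe ∷ pes
  increment-All (there x∈) (pe ∷ pes) = pe ∷ increment-All x∈ pes

  increment-Any : ∀ {q} {P : R → Set q} {x} {es} (x∈ : x ∈ᵉ es) →
    Any (P ∘ proj₁) es → Any (P ∘ proj₁) (increment es x∈)
  increment-Any (here _)   (here pe)   = here pe
  increment-Any (here _)   (there pes) = there pes
  increment-Any (there x∈) (here pe)   = here pe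
  increment-Any (there x∈) (there pes) = there (increment-Any x∈ pes)

  increment-sorted : ∀ {x es} (x∈ : x ∈ᵉ es) →
    AllPairs _<₁_ es → AllPairs _<₁_ (increment es x∈)
  increment-sorted (here _)                    (e< ∷ s) = e< ∷ s
  increment-sorted {es = (e , _) ∷ _} (there x∈) (e< ∷ s) =
    increment-All {P = e <_} x∈ e< ∷ increment-sorted x∈ s

  increment-size : ∀ {x es} (x∈ : x ∈ᵉ es) →
    sum (map (suc ∘ proj₂) (increment es x∈)) ≡ suc (sum (map (suc ∘ proj₂) es))
  increment-size (here _) = ≡.refl
  increment-size {es = (e , k) ∷ es} (there x∈) =
    ≡.trans (≡.cong (suc k ℕ.+_) (increment-size x∈)) (ℕ.+-suc (suc k) _)

  -- Sortedness is what makes the new leaf apart from the weights of all other groups, as each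
  -- `skip` demands.
  increment-occurs : ∀ {p} {d : Vector R (suc p)} {es} (d₀∈ : d zero ∈ᵉ es) →
    AllPairs _<₁_ es → All (λ (e , k) → Occurs e (suc k) (d ∘ suc)) es →
    All (λ (e , k) → Occurs e (suc k) d) (increment es d₀∈)
  increment-occurs (here d₀≈e) (e< ∷ _) (o ∷ os) =
    keep d₀≈e o ∷ All.zipWith (λ (e<f , o) → skip (<⇒# (<-respˡ-≈ (sym d₀≈e) e<f)) o) (e< , os)
  increment-occurs (there d₀∈) (e< ∷ s) (o ∷ os) =
    skip (let e<f , d₀≈f = All.lookupAny e< d₀∈ in >⇒# (<-respʳ-≈ (sym d₀≈f) e<f)) o
      ∷ increment-occurs d₀∈ s os

  join-group : ∀ {p} {d : Vector R (suc p)} {es} → Grouping (d ∘ suc) es →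
    (d₀∈ : d zero ∈ᵉ es) → Grouping d (increment es d₀∈)
  join-group {d = d} g d₀∈ = record
    { sorted  = increment-sorted d₀∈ sorted
    ; occurs  = increment-occurs d₀∈ sorted occurs
    ; covered = λ { zero → increment-Any {P = d zero ≈_} d₀∈ d₀∈
                  ; (suc i) → increment-Any {P = d (suc i) ≈_} d₀∈ (covered i) }
    ; size    = ≡.trans (increment-size d₀∈) (≡.cong suc size)
    }
    where open Grouping g

  insert : ∀ x {es} → x #ᵉ es → AllPairs _<₁_ es →
    ∃[ es′ ] es′ ↭ (x , 0) ∷ es × AllPairs _<₁_ es′
  insert x {[]}           []          _        = (x , 0) ∷ [] , ↭-refl , [] ∷ []
  insert x {(e , k) ∷ es} (x#e ∷ x#es) (e< ∷ s) with #⇒<⊎> x#e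
  ... | inj₁ x<e = (x , 0) ∷ (e , k) ∷ es , ↭-refl ,
    (x<e ∷ All.map (<-trans x<e) e<) ∷ e< ∷ s
  ... | inj₂ e<x = let es′ , es′↭ , s′ = insert x x#es s in
    (e , k) ∷ es′ , ↭-trans (prep (e , k) es′↭) (swap (e , k) (x , 0) ↭-refl) ,
    All-resp-↭ (↭-sym es′↭) (e<x ∷ e<) ∷ s′

  ¬¬-member : ∀ x es → ¬ ¬ (x ∈ᵉ es ⊎ x #ᵉ es)
  ¬¬-member x []             k = k (inj₂ [])
  ¬¬-member x ((e , _) ∷ es) k = ¬¬-member x es λ where
    (inj₁ x∈)   → k (inj₁ (there x∈))
    (inj₂ x#es) → ¬¬-trichotomous x e λ where
      (inj₁ x<e)        → k (inj₂ (<⇒# x<e ∷ x#es))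
      (inj₂ (inj₁ x≈e)) → k (inj₁ (here x≈e))
      (inj₂ (inj₂ e<x)) → k (inj₂ (>⇒# e<x ∷ x#es))

  ¬¬-grouping : ∀ {p} (d : Vector R p) → ¬ ¬ ∃ (Grouping d)
  ¬¬-grouping {zero}  d k = k ([] , grouping-[])
  ¬¬-grouping {suc p} d k = ¬¬-grouping (d ∘ suc) λ (es , g) → ¬¬-member (d zero) es λ where
    (inj₁ d₀∈)   → k (increment es d₀∈ , join-group g d₀∈)
    (inj₂ d₀#es) → let es′ , es′↭ , s = insert (d zero) d₀#es (Grouping.sorted g) in
      k (es′ , new-group g d₀#es es′↭ s)

  -- Takes the weights `x + 1`, `x + 2` and so on. A new least weight `y` first gets a single leaf,
  -- and `repeat` then adds `k` more; the lower bound `x` becomes positivity when `x` is 0.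
  realise : ∀ x (ks : List ℕ) → ∃[ p ] ∃[ d ] ∃[ es ]
    Grouping {p} d es × map proj₂ es ≡ ks × x <ᵉ es
  realise x []       = 0 , (λ ()) , [] , grouping-[] , ≡.refl , []
  realise x (k ∷ ks) =
    let p , d , es , g , eq , y<es = realise y ks
        d′ = y ∷ᵛ d
        g′ = new-group {d = d′} g (All.map <⇒# y<es) ↭-refl (y<es ∷ Grouping.sorted g)
        q , f , h = repeat k g′
    in q , f , (y , k) ∷ es , h , ≡.cong₂ _∷_ ≡.refl eq , x<y ∷ All.map (<-trans x<y) y<es
    where
    y = x + 1#

    x<y : x < y
    x<y = <-by 0<1 (solve 1 (λ x → (x :+ :1) :- x := :1) refl x)

    repeat : ∀ k {p es} {d : Vector R p} → Grouping d ((y , 0) ∷ es) →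
      ∃[ q ] ∃[ f ] Grouping {q} f ((y , k) ∷ es)
    repeat zero    g = _ , _ , g
    repeat (suc k) g = let q , f , h = repeat k g in
      suc q , y ∷ᵛ f , join-group {d = y ∷ᵛ f} h (here refl)

-- The spectrum of a star and the two directions of the theorem.

module StarSpectra {c ℓ₁ ℓ₂ : Level} (ℝ : RealNumbers c ℓ₁ ℓ₂) where
  open RealProperties ℝ
  open Spectrum ℝ
  open Occurrences ℝ
  open Groupings ℝ
  open StarMatrices ℝ

  value : (ps : List (R × ℕ)) → Vector R (length (map proj₂ ps))
  value ((x , _) ∷ ps) zero    = x
  value (_       ∷ ps) (suc i) = value ps i

  value-All : ∀ {q} {P : R × ℕ → Set q} {ps} → All P ps →
    ∀ i → P (value ps i , lookup (map proj₂ ps) i)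
  value-All (p ∷ _)  zero    = p
  value-All (_ ∷ ps) (suc i) = value-All ps i

  value-increasing : ∀ {ps} → AllPairs _<₁_ ps → ∀ i j → i Fin.< j → value ps i < value ps j
  value-increasing (x< ∷ _) zero    (suc j) _         = value-All {P = λ (y , _) → _ < y} x< j
  value-increasing (_ ∷ s)  (suc i) (suc j) (s≤s i<j) = value-increasing s i j i<j

  -- For neighbours x < y in the list, cotransitivity yields x < μ or μ < y. The former removes x
  -- from the list; the latter makes μ apart from all later values, so that it must equal x by
  -- tightness.
  locate : ∀ {μ} ps → AllPairs _<₁_ ps → ¬ μ #ᵉ ps → ∃[ i ] μ ≈ value ps i
  locate []           _        ¬μ#ps = contradiction [] ¬μ#ps
  locate (_ ∷ [])     _        ¬μ#ps = zero , proj₁ (tight _ _) λ μ#x → ¬μ#ps (μ#x ∷ [])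
  locate {μ} (_ ∷ ps@(_ ∷ _)) ((x<y ∷ _) ∷ s@(y< ∷ _)) ¬μ#ps =
    [ (λ x<μ → let i , μ≈ = locate ps s (λ μ#ps → ¬μ#ps (>⇒# x<μ ∷ μ#ps)) in suc i , μ≈)
    , (λ μ<y → zero , proj₁ (tight _ _) λ μ#x →
        ¬μ#ps (μ#x ∷ <⇒# μ<y ∷ All.map (λ y<z → <⇒# (<-trans μ<y y<z)) y<))
    ]′ (<-cotrans x<y μ)

  eigenvalue-resp : ∀ {n} {A : Matrix n} {μ ν} → μ ≈ ν → IsEigenvalue A μ → IsEigenvalue A ν
  eigenvalue-resp μ≈ν (v , v#0 , Av≈μv) = v , v#0 , λ i → trans (Av≈μv i) (*-congʳ μ≈ν)

  ordered-list : ∀ {n} {A : Matrix n} (ps : List (R × ℕ)) → AllPairs _<₁_ ps →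
    All (λ (x , m) → IsEigenvalue A x × HasMultiplicity A x m) ps →
    (∀ {μ} → IsEigenvalue A μ → ¬ μ #ᵉ ps) →
    IsOrderedMultiplicityList A (map proj₂ ps)
  ordered-list {A = A} ps sorted eigenvalues complete = record
    { eigenvalue   = value ps
    ; increasing   = value-increasing sorted
    ; spectrum     = λ μ → mk⇔
        (λ μ∈ → locate ps sorted (complete μ∈))
        (λ (i , μ≈) → eigenvalue-resp {A = A} (sym μ≈) (proj₁ (value-All eigenvalues i)))
    ; multiplicity = λ i → proj₂ (value-All eigenvalues i)
    }

  module _ {p} {A : Matrix (suc p)} {d : Vector R p}
           (laplacian : IsStarLaplacian A d) (d-pos : ∀ i → 0# < d i) where
    open SecularEquation ℝ d d-pos
    open StarEigen laplacian d-pos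

    pole-pos : ∀ {e k} → Occurs e (suc k) d → 0# < e
    pole-pos o = let i , di≈e = occurs-at o in <-respʳ-≈ di≈e (d-pos i)

    below-poles : ∀ {μ} → (∀ i → μ < d i) → μ # 0# → ¬ IsEigenvalue A μ
    below-poles {μ} μ<d μ#0 μ∈ =
      let w , wμ = inverses (λ i → <⇒# (μ<d i)) in
      ∑-nonNeg {f = λ i → - (d i * w i)}
        (λ i → <-asym (<-respʳ-≈
          (solve 2 (λ d w → d :* (:- w) := :- (d :* w)) refl (d i) (w i))
          (*-pos (d-pos i) (pos-left (wμ i) (μ<d i)))))
        (<-by 0<1 (trans
          (+-congˡ (-‿cong (trans (∑-neg (λ i → d i * w i)) (-‿cong (eigenvalue-off-poles μ∈ μ#0 wμ)))))
          (solve 0 (:0 :- (:- :1) := :1) refl)))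

    Listed : R × ℕ → Set (c ⊔ ℓ₁ ⊔ ℓ₂)
    Listed (x , m) = IsEigenvalue A x × HasMultiplicity A x m

    -- The nonzero eigenvalues from e on, where e is the first weight in es.
    record SpectrumFrom (e : R) (es : List (R × ℕ)) : Set (c ⊔ ℓ₁ ⊔ ℓ₂) where
      field
        ps             : List (R × ℕ)
        multiplicities : map proj₂ ps ≡ expand (map proj₂ es)
        sorted         : AllPairs _<₁_ ps
        above          : e ≤ᵉ ps
        eigenvalues    : All Listed ps
        complete       : ∀ {μ} → IsEigenvalue A μ → μ # 0# → e ≤ μ → ¬ μ #ᵉ ps

    -- Completeness is a negation, so the position of `μ` relative to `e` may be split into cases.
    -- This matters for `k = 0`, where `e` is not listed and the case `e ≈ μ` is refuted by
    -- `simple-pole`.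
    pole-then-root : ∀ {e k ρ es ps} → Occurs e (suc k) d → e < ρ → IsRoot ρ →
      map proj₂ ps ≡ expand (map proj₂ es) → AllPairs _<₁_ ps →
      ρ <ᵉ ps → All Listed ps →
      (∀ {μ} → IsEigenvalue A μ → μ # 0# → e < μ → μ # ρ → ¬ μ #ᵉ ps) →
      SpectrumFrom e ((e , k) ∷ es)
    pole-then-root {e} {zero} {ρ} {es} {ps} o e<ρ root eq s ρ< eigen complete = record
      { ps = (ρ , 1) ∷ ps
      ; multiplicities = ≡.cong (1 ∷_) eq
      ; sorted = ρ< ∷ s
      ; above = <-asym e<ρ ∷ All.map (λ ρ<x → <-asym (<-trans e<ρ ρ<x)) ρ<
      ; eigenvalues = (root-eigenvalue root , root-multiplicity root) ∷ eigen
      ; complete = λ { {μ} μ∈ μ#0 e≤μ (μ#ρ ∷ μ#ps) → ¬¬-trichotomous e μ λ where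
          (inj₁ e<μ)        → complete μ∈ μ#0 e<μ μ#ρ μ#ps
          (inj₂ (inj₁ e≈μ)) → simple-pole o (pole-pos o) (eigenvalue-resp {A = A} (sym e≈μ) μ∈)
          (inj₂ (inj₂ μ<e)) → e≤μ μ<e }
      }
    pole-then-root {e} {suc k} {ρ} {es} {ps} o e<ρ root eq s ρ< eigen complete = record
      { ps = (e , suc k) ∷ (ρ , 1) ∷ ps
      ; multiplicities = ≡.cong (λ ms → suc k ∷ 1 ∷ ms) eq
      ; sorted = (e<ρ ∷ All.map (<-trans e<ρ) ρ<) ∷ ρ< ∷ s
      ; above = <-irrefl refl ∷ <-asym e<ρ ∷ All.map (λ ρ<x → <-asym (<-trans e<ρ ρ<x)) ρ<
      ; eigenvalues = (pole-eigenvalue o (pole-pos o) , pole-multiplicity o (pole-pos o))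
          ∷ (root-eigenvalue root , root-multiplicity root) ∷ eigen
      ; complete = λ { {μ} μ∈ μ#0 e≤μ (μ#e ∷ μ#ρ ∷ μ#ps) →
          [ (λ μ<e → e≤μ μ<e) , (λ e<μ → complete μ∈ μ#0 e<μ μ#ρ μ#ps) ]′ (#⇒<⊎> μ#e) }
      }

    -- Recursion over the weights from `e` upwards. `cover` keeps track of the leaves whose weights
    -- have been passed, so that `e` and the next weight bound an interval free of poles.
    spectrum-from : ∀ {e k} es → AllPairs _<₁_ ((e , k) ∷ es) →
      All (λ (e , k) → Occurs e (suc k) d) ((e , k) ∷ es) →
      (∀ i → d i < e ⊎ d i ∈ᵉ ((e , k) ∷ es)) →
      SpectrumFrom e ((e , k) ∷ es)
    spectrum-from {e} {k} [] _ (o ∷ []) cover =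
      pole-then-root o e<ρ root ≡.refl [] [] [] λ μ∈ μ#0 e<μ μ#ρ _ →
        let w , wμ = inverses (λ i → >⇒# (≤-<-trans (d≤e i) e<μ))
            r , rρ , Sr≈1 = root
        in proj₂ (tight _ _) (root-unique i₀
            (λ i → *-pos (pos-right (wμ i) (≤-<-trans (d≤e i) e<μ)) (pos-right (rρ i) (≤-<-trans (d≤e i) e<ρ)))
            wμ rρ (eigenvalue-off-poles μ∈ μ#0 wμ) Sr≈1) μ#ρ
      where
      d≤e : ∀ i → d i ≤ e
      d≤e i = [ <-asym , (λ { (here di≈e) → ≈⇒≤ di≈e }) ]′ (cover i)

      i₀ = proj₁ (occurs-at o)
      beyond = root-beyond d≤e (proj₂ (occurs-at o))
      e<ρ = proj₁ (proj₂ beyond)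
      root = proj₂ (proj₂ beyond)
    spectrum-from {e} {k} ((f , l) ∷ es) ((e<f ∷ e<es) ∷ f<es ∷ s) (o ∷ o′ ∷ os) cover =
      pole-then-root o e<ρ root Rest.multiplicities Rest.sorted
        (All.map (<-≤-trans ρ<f) Rest.above) Rest.eigenvalues
        λ {μ} μ∈ μ#0 e<μ μ#ρ μ#ps → Rest.complete μ∈ μ#0
          -- An eigenvalue strictly between `e` and `f` solves the secular equation, hence equals
          -- `ρ`, against `μ # ρ`. So `f ≤ μ`, and the rest of the list takes over.
          (λ μ<f → let w , wμ = inverses (avoids-poles e<μ μ<f)
                       r , rρ , Sr≈1 = root
            in proj₂ (tight _ _) (root-unique i₀ (same-signs e<μ μ<f e<ρ ρ<f wμ rρ)
                wμ rρ (eigenvalue-off-poles μ∈ μ#0 wμ) Sr≈1) μ#ρ)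
          μ#ps
      where
      sides : ∀ i → d i ≤ e ⊎ f ≤ d i
      sides i = side (cover i)
        where
        side : d i < e ⊎ d i ∈ᵉ ((e , k) ∷ (f , l) ∷ es) → d i ≤ e ⊎ f ≤ d i
        side (inj₁ di<e)                = inj₁ (<-asym di<e)
        side (inj₂ (here di≈e))         = inj₁ (≈⇒≤ di≈e)
        side (inj₂ (there (here di≈f))) = inj₂ (≈⇒≤ (sym di≈f))
        side (inj₂ (there (there di∈))) = let f<g , di≈g = All.lookupAny f<es di∈ in
          inj₂ (<-asym (<-respʳ-≈ (sym di≈g) f<g))

      cover′ : ∀ i → d i < f ⊎ d i ∈ᵉ ((f , l) ∷ es)
      cover′ i = advance (cover i)
        where
        advance : d i < e ⊎ d i ∈ᵉ ((e , k) ∷ (f , l) ∷ es) →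
          d i < f ⊎ d i ∈ᵉ ((f , l) ∷ es)
        advance (inj₁ di<e)        = inj₁ (<-trans di<e e<f)
        advance (inj₂ (here di≈e)) = inj₁ (<-respˡ-≈ (sym di≈e) e<f)
        advance (inj₂ (there di∈)) = inj₂ di∈

      open Gap e<f sides using (avoids-poles; same-signs)
      module Rest = SpectrumFrom (spectrum-from {f} {l} es (f<es ∷ s) (o′ ∷ os) cover′)

      i₀ = proj₁ (occurs-at o)
      gap-root = root-in-gap e<f sides (proj₂ (occurs-at o)) (proj₂ (occurs-at o′))
      e<ρ = proj₁ (proj₂ gap-root)
      ρ<f = proj₁ (proj₂ (proj₂ gap-root))
      root = proj₂ (proj₂ (proj₂ gap-root))

    star-multiplicity-list : ∀ {es} → Grouping d es →
      IsOrderedMultiplicityList A (1 ∷ expand (map proj₂ es))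
    star-multiplicity-list {[]} g =
      ordered-list ((0# , 1) ∷ []) ([] ∷ []) ((zero-eigenvalue , zero-multiplicity) ∷ [])
        λ { μ∈ (μ#0 ∷ []) → below-poles (λ i → contradiction (covered i) λ ()) μ#0 μ∈ }
      where open Grouping g
    star-multiplicity-list {(e , k) ∷ es} g = ≡.subst (λ ms → IsOrderedMultiplicityList A (1 ∷ ms)) F.multiplicities
      (ordered-list ((0# , 1) ∷ F.ps)
        (All.map (<-≤-trans 0<e) F.above ∷ F.sorted)
        ((zero-eigenvalue , zero-multiplicity) ∷ F.eigenvalues)
        λ { {μ} μ∈ (μ#0 ∷ μ#ps) → F.complete μ∈ μ#0
              (λ μ<e → below-poles (λ i → μ<d μ<e (covered i) sorted) μ#0 μ∈) μ#ps })
      where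
      open Grouping g
      module F = SpectrumFrom (spectrum-from {e} {k} es sorted occurs (λ i → inj₂ (covered i)))

      0<e = pole-pos (All.head occurs)

      μ<d : ∀ {μ x} → μ < e → x ∈ᵉ ((e , k) ∷ es) →
        AllPairs _<₁_ ((e , k) ∷ es) → μ < x
      μ<d μ<e (here x≈e)  _        = <-respʳ-≈ (sym x≈e) μ<e
      μ<d μ<e (there x∈) (e< ∷ _) = let e<f , x≈f = All.lookupAny e< x∈ in
        <-respʳ-≈ (sym x≈f) (<-trans μ<e e<f)

  -- The list computed from a grouping has the admissible shape, and uniqueness carries this over to
  -- the given list. The grouping itself is merely not impossible, which suffices for a stable
  -- conclusion.
  attained⇒admissible : ∀ {p ms} → AttainedBy (star (suc p)) ms → Admissible (suc p) ms
  attained⇒admissible {p} {ms} (A , A∈𝒮ᴸ , list) =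
    admissible-stable (suc p) ms λ ¬admissible →
      ¬¬-grouping (weights A) λ (es , g) →
        let ms≡ = multiplicity-list-unique {A = A} list
              (star-multiplicity-list (isStarLaplacian A∈𝒮ᴸ) (weights-pos A∈𝒮ᴸ) g)
        in ¬admissible (≡.subst₂ Admissible
          (≡.cong suc (≡.trans (≡.cong sum (≡.sym (map-∘ es))) (Grouping.size g)))
          (≡.sym ms≡) (expand-admissible (map proj₂ es)))
    where
    open Multiplicities ℝ

  admissible⇒attained : ∀ {p ms} → Admissible (suc p) ms → AttainedBy (star (suc p)) ms
  admissible⇒attained {p} {ms} admissible
    with ks , ≡.refl , size-ks ← admissible⇒expand admissible
    with q , d , es , g , ≡.refl , 0<es ← realise 0# ks
    with ≡.refl ← ≡.trans (≡.trans (≡.sym (Grouping.size g)) (≡.cong sum (map-∘ es))) size-ks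
    = starLaplacian d , starLaplacian∈𝒮ᴸ d d-pos ,
      star-multiplicity-list (starLaplacian-isStarLaplacian d) d-pos g
    where
    d-pos : ∀ i → 0# < d i
    d-pos i = let 0<e , di≈e = All.lookupAny 0<es (Grouping.covered g i) in
      <-respʳ-≈ (sym di≈e) 0<e

open import Data.Nat.Base using (_≤_)

theorem3p4 : ∀ {c ℓ₁ ℓ₂} (ℝ : RealNumbers c ℓ₁ ℓ₂) (n : ℕ) → 2 ≤ n →
    (ms : List ℕ) → Spectrum.AttainedBy ℝ (star n) ms ⇔ Admissible n ms
theorem3p4 ℝ (suc p) _ ms = mk⇔ attained⇒admissible admissible⇒attained
  where open StarSpectra ℝ
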